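{- Fix integers $k,N\ge1$. For each integer $n\ge N+1$, let $p_{k,N}(n)$ denote the probability that a (uniformly random) $k$-tuple of functions between $k$ sets of cardinality $n$ is eventually $N$-cyclic. Then $$p_{k,N}(n)=\frac1N\,n^{ -k(N-1)}\left(\frac{(n-1)!}{(n-N)!}\right)^k\left(1-\left(1-\frac Nn\right)^k\right),$$ and, as $n\to\infty$, $$p_{k,N}(n)=\frac kn+\mathcal O\left(\frac1{n^2}\right).$$
   Context: The $k$ sets $X_1,\dots,X_k$ are pairwise disjoint, indices are modulo $k$, and a $k$-tuple of functions means $(f_1,\dots,f_k)$ with $f_i:X_i\to X_{i+1}$ ($X_{k+1}=X_1$); there are $n^{kn}$ such tuples and $p_{k,N}(n)$ is the proportion that are eventually $N$-cyclic. The tuple is eventually $N$-cyclic if the iterated images $(f_k\cdots f_1)^m(X_1)$ eventually stabilize (for large $m$) to a subset of $X_1$ of cardinality $N$ on which $f_k\cdots f_1$ acts as an $N$-cycle (a single cyclic permutation of all $N$ elements). -}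

module Defs where

open import Data.Fin.Base using (Fin; toℕ; finToFun; funToFin)
open import Data.Fin.Properties
  using (_≟_; any?; all?; toℕ≤pred[n]; pigeonhole; finToFun-funToFin)
open import Data.Fin.Subset using (Subset; _∈_; ∣_∣)
open import Data.Fin.Subset.Properties using (_∈?_; anySubset?)
open import Data.Integer.Base as ℤ using ()
open import Data.List.Base as List using (List; allFin; filter; length)
open import Data.Nat.Base as ℕ using (ℕ; suc; _+_; _*_; _∸_; _≤_; NonZero)
open import Data.Nat.DivMod using (_mod_)
import Data.Nat.Properties as ℕ
open import Data.Product.Base using (∃; _×_; _,_)
open import Data.Rational.Base using (ℚ; _/_)
open import Data.Vec.Functional using (Vector; foldr)
open import Function.Base using (id; _∘_)
open import Function.Bundles using (_⇔_; mk⇔; Equivalence)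
open import Function.Definitions using (Injective)
import Function.Endo.Propositional as Endo
open import Relation.Binary.PropositionalEquality
open import Relation.Nullary.Decidable using (Dec; map′; _×-dec_; _→-dec_)

-- Iterated composition of a self-map:  (F ^∘ m) = F ∘ ⋯ ∘ F  (m factors).
open module Iteration {n : ℕ} = Endo (Fin n) using () renaming (_^_ to _^∘_) public

-- The set X_{i+1} is the i-th labelled copy of Fin n; the labels (and hence
-- disjointness) are carried by the position in the tuple.  The entry at
-- position i is the map from X_{i+1} to X_{i+2}, the last one returning to X₁.
Tuple : ℕ → ℕ → Set
Tuple k n = Vector (Fin n → Fin n) k

-- f_k ∘ ⋯ ∘ f₁ : X₁ → X₁, where f₁ is at index zero and is applied first.
compose : ∀ {k n} → Tuple k n → Fin n → Fin n
compose = foldr (λ g h → h ∘ g) id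

module _ {n : ℕ} (F : Fin n → Fin n) where

  IsIteratedImage : ℕ → Subset n → Set
  IsIteratedImage m S = ∀ y → y ∈ S ⇔ (∃ λ x → (F ^∘ m) x ≡ y)

  -- S = {a₀, …, a_{N-1}} with the aᵢ distinct, and F restricts to the
  -- cyclic permutation (a₀ a₁ ⋯ a_{N-1}) of S.
  ActsAsCycle : (N : ℕ) .{{_ : NonZero N}} → Subset n → Set
  ActsAsCycle N S = ∃ λ (a : Fin N → Fin n) →
    Injective _≡_ _≡_ a ×
    (∀ y → y ∈ S ⇔ (∃ λ i → a i ≡ y)) ×
    (∀ i → F (a i) ≡ a (suc (toℕ i) mod N))

EventuallyCyclic : ∀ {k n} (N : ℕ) .{{_ : NonZero N}} → Tuple k n → Set
EventuallyCyclic N f = ∃ λ S →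
  (∃ λ M → ∀ m → M ≤ m → IsIteratedImage (compose f) m S) ×
  ∣ S ∣ ≡ N ×
  ActsAsCycle (compose f) N S

private

  infix 3 _⇔?_
  _⇔?_ : ∀ {A B : Set} → Dec A → Dec B → Dec (A ⇔ B)
  a? ⇔? b? = map′ (λ (f , g) → mk⇔ f g)
                  (λ e → Equivalence.to e , Equivalence.from e)
                  ((a? →-dec b?) ×-dec (b? →-dec a?))

  ∃-map : ∀ {A : Set} {P Q : A → Set} → (∀ x → P x → Q x) → ∃ P → ∃ Q
  ∃-map h (x , p) = x , h x p

module _ {n : ℕ} (F : Fin n → Fin n) where

  private

    ^∘-+ : ∀ m l x → (F ^∘ (m + l)) x ≡ (F ^∘ m) ((F ^∘ l) x)
    ^∘-+ ℕ.zero  l x = refl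
    ^∘-+ (suc m) l x = cong F (^∘-+ m l x)

    -- After n steps every orbit is periodic, by the pigeonhole principle.
    periodic : ∀ x → ∃ λ p → (F ^∘ suc p) ((F ^∘ n) x) ≡ (F ^∘ n) x
    periodic x with pigeonhole (ℕ.n<1+n n) (λ i → (F ^∘ toℕ i) x)
    ... | i , j , i<j , eq = p , (begin
      (F ^∘ suc p) ((F ^∘ n) x)           ≡⟨ ^∘-+ (suc p) n x ⟨
      (F ^∘ (suc p + n)) x                ≡⟨ cong (λ t → (F ^∘ t) x) shift ⟩
      (F ^∘ (q + toℕ j)) x                ≡⟨ ^∘-+ q (toℕ j) x ⟩
      (F ^∘ q) ((F ^∘ toℕ j) x)           ≡⟨ cong (F ^∘ q) eq ⟨
      (F ^∘ q) ((F ^∘ toℕ i) x)           ≡⟨ ^∘-+ q (toℕ i) x ⟨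
      (F ^∘ (q + toℕ i)) x                ≡⟨ cong (λ t → (F ^∘ t) x) q+i≡n ⟩
      (F ^∘ n) x                          ∎)
      where
      open ≡-Reasoning
      p = toℕ j ∸ suc (toℕ i)
      q = n ∸ toℕ i
      q+i≡n : q + toℕ i ≡ n
      q+i≡n = ℕ.m∸n+n≡m (toℕ≤pred[n] i)
      shift : suc p + n ≡ q + toℕ j
      shift = begin
        suc p + n               ≡⟨ cong (λ t → suc p + t) q+i≡n ⟨
        suc p + (q + toℕ i)     ≡⟨ ℕ.+-comm (suc p) (q + toℕ i) ⟩
        q + toℕ i + suc p       ≡⟨ ℕ.+-assoc q (toℕ i) (suc p) ⟩
        q + (toℕ i + suc p)     ≡⟨ cong (λ t → q + t) (ℕ.+-suc (toℕ i) p) ⟩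
        q + (suc (toℕ i) + p)   ≡⟨ cong (λ t → q + t) (ℕ.m+[n∸m]≡n i<j) ⟩
        q + toℕ j               ∎

    loop : ∀ p y → (F ^∘ suc p) y ≡ y → ∀ t → (F ^∘ (t * suc p)) y ≡ y
    loop p y eq ℕ.zero  = refl
    loop p y eq (suc t) = trans (^∘-+ (suc p) (t * suc p) y)
                                (trans (cong (F ^∘ suc p) (loop p y eq t)) eq)

    later : ∀ m → n ≤ m → ∀ y →
            (∃ λ x → (F ^∘ n) x ≡ y) ⇔ (∃ λ x → (F ^∘ m) x ≡ y)
    later m n≤m y = mk⇔ to from
      where
      to : (∃ λ x → (F ^∘ n) x ≡ y) → (∃ λ x → (F ^∘ m) x ≡ y)
      to (x , refl) with periodic x
      ... | p , eq = (F ^∘ (m * suc p ∸ m)) ((F ^∘ n) x) , (begin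
        (F ^∘ m) ((F ^∘ (m * suc p ∸ m)) ((F ^∘ n) x))
          ≡⟨ ^∘-+ m (m * suc p ∸ m) ((F ^∘ n) x) ⟨
        (F ^∘ (m + (m * suc p ∸ m))) ((F ^∘ n) x)
          ≡⟨ cong (λ t → (F ^∘ t) ((F ^∘ n) x)) (ℕ.m+[n∸m]≡n (ℕ.m≤m*n m (suc p))) ⟩
        (F ^∘ (m * suc p)) ((F ^∘ n) x)
          ≡⟨ loop p ((F ^∘ n) x) eq m ⟩
        (F ^∘ n) x ∎)
        where open ≡-Reasoning
      from : (∃ λ x → (F ^∘ m) x ≡ y) → (∃ λ x → (F ^∘ n) x ≡ y)
      from (x , eq) = (F ^∘ (m ∸ n)) x ,
        trans (sym (^∘-+ n (m ∸ n) x))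
              (trans (cong (λ t → (F ^∘ t) x) (ℕ.m+[n∸m]≡n n≤m)) eq)

  isIteratedImage? : ∀ m S → Dec (IsIteratedImage F m S)
  isIteratedImage? m S =
    all? λ y → (y ∈? S) ⇔? any? (λ x → (F ^∘ m) x ≟ y)

  stable? : ∀ S → Dec (∃ λ M → ∀ m → M ≤ m → IsIteratedImage F m S)
  stable? S = map′ to from (isIteratedImage? n S)
    where
    open Equivalence using () renaming (to to ⇒; from to ⇐)
    to : IsIteratedImage F n S → ∃ λ M → ∀ m → M ≤ m → IsIteratedImage F m S
    to h = n , λ m n≤m y → mk⇔ (⇒ (later m n≤m y) ∘ ⇒ (h y))
                               (⇐ (h y) ∘ ⇐ (later m n≤m y))
    from : (∃ λ M → ∀ m → M ≤ m → IsIteratedImage F m S) → IsIteratedImage F n S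
    from (M , h) y =
      let m   = M ℕ.⊔ n
          h′  = h m (ℕ.m≤m⊔n M n) y
          n≤m = ℕ.m≤n⊔m M n
      in mk⇔ (⇐ (later m n≤m y) ∘ ⇒ h′) (⇐ h′ ∘ ⇒ (later m n≤m y))

  actsAsCycle? : ∀ (N : ℕ) .{{_ : NonZero N}} S → Dec (ActsAsCycle F N S)
  actsAsCycle? N S = map′ (λ (c , h) → finToFun c , h)
                          (λ (a , h) → funToFin a , transport a h)
                          (any? λ c → enumerates? (finToFun c))
    where
    Enumerates : (Fin N → Fin n) → Set
    Enumerates a = Injective _≡_ _≡_ a ×
                   (∀ y → y ∈ S ⇔ (∃ λ i → a i ≡ y)) ×
                   (∀ i → F (a i) ≡ a (suc (toℕ i) mod N))

    enumerates? : ∀ a → Dec (Enumerates a)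
    enumerates? a =
      map′ (λ h {i} {j} → h i j) (λ h i j → h {i} {j})
           (all? λ i → all? λ j → (a i ≟ a j) →-dec (i ≟ j))
      ×-dec (all? λ y → (y ∈? S) ⇔? any? (λ i → a i ≟ y))
      ×-dec (all? λ i → F (a i) ≟ a (suc (toℕ i) mod N))

    transport : ∀ a → Enumerates a → Enumerates (finToFun (funToFin a))
    transport a (inj , onto , step) =
      (λ {i} {j} eq → inj (trans (sym (b≗a i)) (trans eq (b≗a j)))) ,
      (λ y → mk⇔
        (∃-map (λ i → trans (b≗a i)) ∘ Equivalence.to (onto y))
        (Equivalence.from (onto y) ∘ ∃-map (λ i → trans (sym (b≗a i))))) ,
      (λ i → trans (cong F (b≗a i)) (trans (step i) (sym (b≗a _))))
      where
      b≗a : finToFun (funToFin a) ≗ a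
      b≗a = finToFun-funToFin a

eventuallyCyclic? : ∀ {k n} (N : ℕ) .{{_ : NonZero N}} (f : Tuple k n) →
                    Dec (EventuallyCyclic N f)
eventuallyCyclic? N f = anySubset? λ S →
  stable? (compose f) S ×-dec (∣ S ∣ ℕ.≟ N) ×-dec actsAsCycle? (compose f) N S

-- All n ^ (k * n) tuples, each listed once up to pointwise equality:
-- finToFun is the library's bijection between Fin (b ^ m) and Fin m → Fin b.
tuples : ∀ k n → List (Tuple k n)
tuples k n = List.map (λ c i → finToFun {n} {n} (finToFun {n ℕ.^ n} {k} c i))
                      (allFin ((n ℕ.^ n) ℕ.^ k))

p : (k N : ℕ) .{{_ : NonZero N}} (n : ℕ) .{{_ : NonZero n}} → ℚ
p k N n = (ℤ.+ length (filter (eventuallyCyclic? N) (tuples k n)) / (n ℕ.^ (k * n)))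
            {{ℕ.m^n≢0 n (k * n)}}

{-# OPTIONS --safe #-}

-- A tuple is eventually N-cyclic iff F = f_k ∘ ⋯ ∘ f₁ has an N-cycle into
-- which every orbit falls, and that cycle has N enumerations (aᵢ) in cyclic
-- order.  Fix h = f_k ∘ ⋯ ∘ f₂ and give x the weight w x = |h⁻¹(x)|, of total
-- n.  Summing over f₁ is a weighted count of self-maps F with a prescribed
-- attracting cycle, i.e. of rooted forests, and contracting vertices one at a
-- time gives ∏ w(aᵢ) · Σ w(aᵢ) · n^(n-N-1).  Expanding the fibre sizes, what
-- remains is to count the (f₂, …, f_k) together with N points kept distinct
-- by h and one more point that h sends to the image of one of them: all pairs
-- minus those where N + 1 points are kept distinct.  With ε = 1/n this reads
--   N · p = (∏_{i<N} (1 - iε))ᵏ · (1 - (1 - Nε)ᵏ),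
-- a polynomial in ε whose expansion at 0 gives the asymptotics.
module Submission where

open import Defs

-- The exponent n-N-1 is -1 when N = n, so the counts are identities in ℕ with powers of n moved to
-- the other side, and division starts only in ℚ. Contraction destroys uniformity, since a merged
-- vertex collects the weight of both; the forest count is therefore stated for arbitrary weights,
-- transported by pushforward. The same pushforward turns a uniform f₁ followed by h into
-- independent values weighted by fibre sizes. Cycle points become roots, and one artificial root is
-- added, so that a root always remains to contract into. In the last count, h keeps points distinct
-- exactly if each of its factors keeps their successive images distinct. Each of the k-1 maps thus
-- contributes the same factor, and the choice of the points contributes one more: this is the
-- source of the k-th powers.

module Counting where

  open import Algebra.Bundles using (CommutativeMonoid)
  import Algebra.Properties.CommutativeMonoid.Sum as CMSum
  import Algebra.Properties.Monoid.Mult as MonoidMult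
  open import Data.Bool.Base using (Bool; true; false; if_then_else_)
  open import Data.Fin.Base using (Fin; zero; suc; toℕ; fromℕ; inject₁; combine; quotient; remainder; finToFun; _↑ˡ_; _↑ʳ_)
  open import Data.Fin.Properties
    using (_≟_; any?; all?; toℕ<n; toℕ-fromℕ<; toℕ-injective; toℕ-inject₁; toℕ-fromℕ; remQuot-combine; suc-injective)
  open import Data.Fin.Subset using (Subset; _∈_; ∣_∣)
  open import Data.Fin.Subset.Properties using (_∈?_; drop-there)
  open import Data.List.Base as List using (List; []; _∷_; allFin; filter; length)
  open import Data.List.Properties using (map-tabulate; length-tabulate)
  open import Data.Nat.Base using (ℕ; zero; suc; _+_; _*_; _∸_; _^_; _≤_; s≤s; NonZero; _!)
  open import Data.Nat.DivMod using (_%_; _/_; _mod_; m≡m%n+[m/n]*n; m<n⇒m%n≡m; n%n≡0; m%n%n≡m%n; %-distribˡ-+)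
  open import Data.Nat.Properties
    using (*-1-commutativeMonoid; *-1-monoid; *-assoc; *-comm; *-distribʳ-+; *-distribˡ-+; *-identityʳ;
      *-identityˡ; *-zeroʳ; +-0-commutativeMonoid; +-0-monoid; +-assoc; +-cancelʳ-≡; +-comm; +-identityʳ;
      +-suc; ^-distribˡ-+-*; ^-zeroˡ; m+[n∸m]≡n; m∸n+n≡m; m≤m*n; m≤m+n; m≤n+m; ≤-refl; ≤-trans)
  open import Data.Nat.Solver using (module +-*-Solver)
  open import Data.Product.Base using (∃; _×_; _,_; proj₁; proj₂)
  open import Data.Vec.Base as Vec using (Vec; []; _∷_; lookup; tabulate; there)
  open import Data.Vec.Functional using (updateAt)
  open import Data.Vec.Functional.Properties using (updateAt-updates; updateAt-minimal)
  open import Data.Vec.Properties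
    using (≡-dec; ∷-injective; lookup-map; lookup∘tabulate; tabulate∘lookup; tabulate-cong; lookup⇒[]=; []=⇒lookup; map-id; map-∘)
  open import Function.Base using (_∘_; id; const)
  open import Function.Bundles using (_⇔_; mk⇔; Equivalence)
  open import Function.Definitions using (Injective)
  open import Relation.Binary.PropositionalEquality hiding (setoid)
  open import Relation.Nullary.Decidable using (Dec; yes; no; does; map′; dec-true; dec-false; _×-dec_; _→-dec_)
  open import Relation.Nullary.Negation using (¬_; contradiction)

  open Equivalence using () renaming (to to ⇒; from to ⇐)

  private variable
    A B C : Set
    k m n N : ℕ

  -- Indicators and finite sums

  module Sum = CMSum +-0-commutativeMonoid
  module Prod = CMSum *-1-commutativeMonoid

  ∏ : (Fin n → ℕ) → ℕ
  ∏ = Prod.sum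

  𝟙 : Dec A → ℕ
  𝟙 (yes _) = 1
  𝟙 (no _)  = 0

  𝟙-yes : (d : Dec A) → A → 𝟙 d ≡ 1
  𝟙-yes (yes _) p = refl
  𝟙-yes (no ¬p) p = contradiction p ¬p

  𝟙-no : (d : Dec A) → ¬ A → 𝟙 d ≡ 0
  𝟙-no (yes p) ¬p = contradiction p ¬p
  𝟙-no (no _)  ¬p = refl

  𝟙-cong : (d : Dec A) (e : Dec B) → (A → B) → (B → A) → 𝟙 d ≡ 𝟙 e
  𝟙-cong (yes p) e f g = sym (𝟙-yes e (f p))
  𝟙-cong (no ¬p) e f g = sym (𝟙-no e (¬p ∘ g))

  𝟙-× : (d : Dec A) (e : Dec B) (r : Dec C) → (A → B × C) → (B → C → A) → 𝟙 d ≡ 𝟙 e * 𝟙 r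
  𝟙-× d (yes q) r f g = trans (𝟙-cong d r (proj₂ ∘ f) (g q)) (sym (+-identityʳ _))
  𝟙-× d (no ¬q) r f g = 𝟙-no d (¬q ∘ proj₁ ∘ f)

  ∑ : List A → (A → ℕ) → ℕ
  ∑ []       f = 0
  ∑ (x ∷ xs) f = f x + ∑ xs f

  ∑-cong : ∀ (xs : List A) {f g : A → ℕ} → f ≗ g → ∑ xs f ≡ ∑ xs g
  ∑-cong []       e = refl
  ∑-cong (x ∷ xs) e = cong₂ _+_ (e x) (∑-cong xs e)

  ∑-+ : ∀ (xs : List A) (f g : A → ℕ) → ∑ xs (λ x → f x + g x) ≡ ∑ xs f + ∑ xs g
  ∑-+ []       f g = refl
  ∑-+ (x ∷ xs) f g = trans (cong (f x + g x +_) (∑-+ xs f g))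
    (solve 4 (λ a b c d → (a :+ b) :+ (c :+ d) := (a :+ c) :+ (b :+ d)) refl (f x) (g x) (∑ xs f) (∑ xs g))
    where open +-*-Solver

  ∑-*ˡ : ∀ (xs : List A) c (f : A → ℕ) → ∑ xs (λ x → c * f x) ≡ c * ∑ xs f
  ∑-*ˡ []       c f = sym (*-zeroʳ c)
  ∑-*ˡ (x ∷ xs) c f = trans (cong (c * f x +_) (∑-*ˡ xs c f)) (sym (*-distribˡ-+ c (f x) (∑ xs f)))

  ∑-*ʳ : ∀ (xs : List A) (f : A → ℕ) c → ∑ xs (λ x → f x * c) ≡ ∑ xs f * c
  ∑-*ʳ xs f c = trans (∑-cong xs (λ x → *-comm (f x) c)) (trans (∑-*ˡ xs c f) (*-comm c _))

  ∑-const : ∀ (xs : List A) c → ∑ xs (λ _ → c) ≡ length xs * c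
  ∑-const []       c = refl
  ∑-const (x ∷ xs) c = cong (c +_) (∑-const xs c)

  ∑-zero : ∀ (xs : List A) → ∑ xs (λ _ → 0) ≡ 0
  ∑-zero xs = trans (∑-const xs 0) (*-zeroʳ (length xs))

  ∑-swap : ∀ (xs : List A) (ys : List B) (f : A → B → ℕ) →
           ∑ xs (λ x → ∑ ys (f x)) ≡ ∑ ys (λ y → ∑ xs (λ x → f x y))
  ∑-swap []       ys f = sym (∑-zero ys)
  ∑-swap (x ∷ xs) ys f = trans (cong (∑ ys (f x) +_) (∑-swap xs ys f)) (sym (∑-+ ys (f x) _))

  ∑-map : ∀ (h : A → B) (xs : List A) (f : B → ℕ) → ∑ (List.map h xs) f ≡ ∑ xs (f ∘ h)
  ∑-map h []       f = refl
  ∑-map h (x ∷ xs) f = cong (f (h x) +_) (∑-map h xs f)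

  ∑-++ : ∀ (xs ys : List A) (f : A → ℕ) → ∑ (xs List.++ ys) f ≡ ∑ xs f + ∑ ys f
  ∑-++ []       ys f = refl
  ∑-++ (x ∷ xs) ys f = trans (cong (f x +_) (∑-++ xs ys f)) (sym (+-assoc (f x) _ _))

  length-filter-∑ : ∀ {P : A → Set} (P? : ∀ x → Dec (P x)) (xs : List A) →
                    length (filter P? xs) ≡ ∑ xs (λ x → 𝟙 (P? x))
  length-filter-∑ P? []       = refl
  length-filter-∑ P? (x ∷ xs) with P? x
  ... | yes _ = cong suc (length-filter-∑ P? xs)
  ... | no  _ = length-filter-∑ P? xs

  ∑Fin : ∀ n → (Fin n → ℕ) → ℕ
  ∑Fin n = ∑ (allFin n)

  ∑Fin-suc : ∀ (f : Fin (suc n) → ℕ) → ∑Fin (suc n) f ≡ f zero + ∑Fin n (f ∘ suc)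
  ∑Fin-suc {n} f = cong (f zero +_)
    (trans (cong (λ l → ∑ l f) (sym (map-tabulate id suc))) (∑-map suc (allFin n) f))

  ∑Fin≡sum : ∀ (f : Fin n → ℕ) → ∑Fin n f ≡ Sum.sum f
  ∑Fin≡sum {zero}  f = refl
  ∑Fin≡sum {suc n} f = trans (∑Fin-suc f) (cong (f zero +_) (∑Fin≡sum (f ∘ suc)))

  ∑Fin-const : ∀ n c → ∑Fin n (λ _ → c) ≡ n * c
  ∑Fin-const n c = trans (∑-const (allFin n) c) (cong (_* c) (length-tabulate {n = n} id))

  ∑Fin-δ : ∀ (y : Fin n) (f : Fin n → ℕ) → ∑Fin n (λ z → 𝟙 (y ≟ z) * f z) ≡ f y
  ∑Fin-δ {suc n} zero f = trans (∑Fin-suc (λ z → 𝟙 (zero ≟ z) * f z))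
    (trans (cong₂ _+_ (+-identityʳ (f zero)) (∑-zero (allFin n))) (+-identityʳ (f zero)))
  ∑Fin-δ {suc n} (suc y) f = trans (∑Fin-suc (λ z → 𝟙 (suc y ≟ z) * f z))
    (trans (∑-cong (allFin n) (λ z → cong (_* f (suc z))
      (𝟙-cong (suc y ≟ suc z) (y ≟ z) suc-injective (cong suc))))
      (∑Fin-δ y (f ∘ suc)))

  -- Sums over maps and pushforward of weights

  vecs : List A → ∀ m → List (Vec A m)
  vecs xs zero    = [] ∷ []
  vecs xs (suc m) = List.concatMap (λ x → List.map (x ∷_) (vecs xs m)) xs

  ∑-vecs-suc : ∀ (xs : List A) m (f : Vec A (suc m) → ℕ) →
               ∑ (vecs xs (suc m)) f ≡ ∑ xs (λ x → ∑ (vecs xs m) (λ v → f (x ∷ v)))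
  ∑-vecs-suc {A} xs m f = go xs
    where
    go : ∀ ys → ∑ (List.concatMap (λ x → List.map (x ∷_) (vecs xs m)) ys) f
              ≡ ∑ ys (λ x → ∑ (vecs xs m) (λ v → f (x ∷ v)))
    go []       = refl
    go (y ∷ ys) = trans (∑-++ (List.map (y ∷_) (vecs xs m)) _ f)
                        (cong₂ _+_ (∑-map (y ∷_) (vecs xs m) f) (go ys))

  -- Maps Fin m → Fin n, represented by their value vectors.
  fun : ∀ m n → List (Vec (Fin n) m)
  fun m n = vecs (allFin n) m

  infix 4 _≟ᵛ_
  _≟ᵛ_ : (v w : Vec (Fin n) m) → Dec (v ≡ w)
  _≟ᵛ_ = ≡-dec _≟_

  ∑-fun-δ : ∀ (v : Vec (Fin n) m) (f : Vec (Fin n) m → ℕ) →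
            ∑ (fun m n) (λ w → 𝟙 (v ≟ᵛ w) * f w) ≡ f v
  ∑-fun-δ {n} {zero} [] f = trans (+-identityʳ _) (+-identityʳ (f []))
  ∑-fun-δ {n} {suc m} (x ∷ v) f = begin
    ∑ (fun (suc m) n) (λ w → 𝟙 ((x ∷ v) ≟ᵛ w) * f w)
      ≡⟨ ∑-vecs-suc (allFin n) m _ ⟩
    ∑Fin n (λ y → ∑ (fun m n) (λ w → 𝟙 ((x ∷ v) ≟ᵛ (y ∷ w)) * f (y ∷ w)))
      ≡⟨ ∑-cong (allFin n) (λ y → trans (∑-cong (fun m n) (λ w →
           trans (cong (_* f (y ∷ w)) (𝟙-× ((x ∷ v) ≟ᵛ (y ∷ w)) (x ≟ y) (v ≟ᵛ w) ∷-injective (cong₂ _∷_)))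
                 (*-assoc (𝟙 (x ≟ y)) _ _)))
           (∑-*ˡ (fun m n) (𝟙 (x ≟ y)) _)) ⟩
    ∑Fin n (λ y → 𝟙 (x ≟ y) * ∑ (fun m n) (λ w → 𝟙 (v ≟ᵛ w) * f (y ∷ w)))
      ≡⟨ ∑Fin-δ x _ ⟩
    ∑ (fun m n) (λ w → 𝟙 (v ≟ᵛ w) * f (x ∷ w))
      ≡⟨ ∑-fun-δ v (f ∘ (x ∷_)) ⟩
    f (x ∷ v) ∎
    where open ≡-Reasoning

  -- Unnormalised law of a random map with independent values, `u x` being the law of the value at
  -- `x`. The laws may depend on `x`, because cycle points and other points will be weighted
  -- differently.
  weight : (Fin m → Fin n → ℕ) → Vec (Fin n) m → ℕ
  weight u F = ∏ (λ x → u x (lookup F x))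

  ∑-weight : ∀ (u : Fin m → Fin n → ℕ) → ∑ (fun m n) (weight u) ≡ ∏ (λ x → ∑Fin n (u x))
  ∑-weight {zero}      u = refl
  ∑-weight {suc m} {n} u = begin
    ∑ (fun (suc m) n) (weight u)
      ≡⟨ ∑-vecs-suc (allFin n) m _ ⟩
    ∑Fin n (λ y → ∑ (fun m n) (λ v → u zero y * weight (u ∘ suc) v))
      ≡⟨ ∑-cong (allFin n) (λ y → ∑-*ˡ (fun m n) (u zero y) _) ⟩
    ∑Fin n (λ y → u zero y * ∑ (fun m n) (weight (u ∘ suc)))
      ≡⟨ ∑-*ʳ (allFin n) (u zero) _ ⟩
    ∑Fin n (u zero) * ∑ (fun m n) (weight (u ∘ suc))
      ≡⟨ cong (∑Fin n (u zero) *_) (∑-weight (u ∘ suc)) ⟩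
    ∏ (λ x → ∑Fin n (u x)) ∎
    where open ≡-Reasoning

  weight-* : ∀ (u v : Fin m → Fin n → ℕ) F → weight (λ x y → u x y * v x y) F ≡ weight u F * weight v F
  weight-* u v F = Prod.∑-distrib-+ (λ x → u x (lookup F x)) (λ x → v x (lookup F x))

  module _ {p q : ℕ} (c : Fin p → Fin q) where

    -- Image measure of `u` under `c`; for `u` constantly 1 these are the fibre sizes of `c`.
    push : (Fin p → ℕ) → Fin q → ℕ
    push u z = ∑Fin p (λ y → 𝟙 (c y ≟ z) * u y)

    ∑-push : ∀ (u : Fin p → ℕ) (f : Fin q → ℕ) →
             ∑Fin q (λ z → push u z * f z) ≡ ∑Fin p (λ y → u y * f (c y))
    ∑-push u f = begin
      ∑Fin q (λ z → push u z * f z)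
        ≡⟨ ∑-cong (allFin q) (λ z → sym (∑-*ʳ (allFin p) _ (f z))) ⟩
      ∑Fin q (λ z → ∑Fin p (λ y → 𝟙 (c y ≟ z) * u y * f z))
        ≡⟨ ∑-swap (allFin q) (allFin p) _ ⟩
      ∑Fin p (λ y → ∑Fin q (λ z → 𝟙 (c y ≟ z) * u y * f z))
        ≡⟨ ∑-cong (allFin p) (λ y → trans (∑-cong (allFin q) (λ z → *-assoc (𝟙 (c y ≟ z)) (u y) (f z)))
                                          (∑Fin-δ (c y) (λ z → u y * f z))) ⟩
      ∑Fin p (λ y → u y * f (c y)) ∎
      where open ≡-Reasoning

    ∑-push-1 : ∀ (u : Fin p → ℕ) → ∑Fin q (push u) ≡ ∑Fin p u
    ∑-push-1 u = trans (∑-cong (allFin q) (λ z → sym (*-identityʳ (push u z))))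
      (trans (∑-push u (λ _ → 1)) (∑-cong (allFin p) (λ y → *-identityʳ (u y))))

    push-cong : ∀ {u v : Fin p → ℕ} → u ≗ v → push u ≗ push v
    push-cong e z = ∑-cong (allFin p) (λ y → cong (𝟙 (c y ≟ z) *_) (e y))

    -- Independence survives postcomposition: the image of a product law under `c` is the product of
    -- the image laws. It serves for contraction, for the inclusion `suc` that makes room for an
    -- extra root, and for the composite of the later maps.
    ∑-fun-push : ∀ (u : Fin m → Fin p → ℕ) (f : Vec (Fin q) m → ℕ) →
                 ∑ (fun m p) (λ F → weight u F * f (Vec.map c F))
                 ≡ ∑ (fun m q) (λ G → weight (push ∘ u) G * f G)
    ∑-fun-push {zero}  u f = refl
    ∑-fun-push {suc m} u f = begin
      ∑ (fun (suc m) p) (λ F → weight u F * f (Vec.map c F))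
        ≡⟨ ∑-vecs-suc (allFin p) m _ ⟩
      ∑Fin p (λ y → ∑ (fun m p) (λ F → u zero y * weight (u ∘ suc) F * f (c y ∷ Vec.map c F)))
        ≡⟨ ∑-cong (allFin p) (λ y → trans
             (∑-cong (fun m p) (λ F → *-assoc (u zero y) (weight (u ∘ suc) F) _))
             (∑-*ˡ (fun m p) (u zero y) _)) ⟩
      ∑Fin p (λ y → u zero y * ∑ (fun m p) (λ F → weight (u ∘ suc) F * f (c y ∷ Vec.map c F)))
        ≡⟨ ∑-cong (allFin p) (λ y → cong (u zero y *_) (∑-fun-push (u ∘ suc) (f ∘ (c y ∷_)))) ⟩
      ∑Fin p (λ y → u zero y * Φ (c y))
        ≡⟨ ∑-push (u zero) Φ ⟨
      ∑Fin q (λ z → push (u zero) z * Φ z)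
        ≡⟨ ∑-cong (allFin q) (λ z → trans (sym (∑-*ˡ (fun m q) (push (u zero) z) _))
             (∑-cong (fun m q) (λ G → sym (*-assoc (push (u zero) z) _ _)))) ⟩
      ∑Fin q (λ z → ∑ (fun m q) (λ G → push (u zero) z * weight (push ∘ u ∘ suc) G * f (z ∷ G)))
        ≡⟨ ∑-vecs-suc (allFin q) m _ ⟨
      ∑ (fun (suc m) q) (λ G → weight (push ∘ u) G * f G) ∎
      where
      open ≡-Reasoning
      Φ : Fin q → ℕ
      Φ z = ∑ (fun m q) (λ G → weight (push ∘ u ∘ suc) G * f (z ∷ G))

  -- Rooted forests and contraction

  module _ {c ℓ} (M : CommutativeMonoid c ℓ) where

    open CommutativeMonoid M renaming (refl to ≈-refl; sym to ≈-sym; trans to ≈-trans; reflexive to ≈-reflexive)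
    open CMSum M using (sum; sum-replicate; sum-cong-≋)
    open MonoidMult monoid using () renaming (_×_ to _×ᴹ_)
    open import Algebra.Solver.CommutativeMonoid M using (solve; _⊕_; _⊜_)
    open import Relation.Binary.Reasoning.Setoid setoid

    -- A general commutative monoid covers both uses of the next lemma: sums, for cardinalities, and
    -- products, for independent choices.
    sum-updateAt : ∀ (u : Fin n → Carrier) y a → sum u ∙ a ≈ u y ∙ sum (updateAt u y (const a))
    sum-updateAt {suc n} u zero    a = solve 3 (λ x s a → (x ⊕ s) ⊕ a ⊜ x ⊕ (a ⊕ s)) ≈-refl (u zero) (sum (u ∘ suc)) a
    sum-updateAt {suc n} u (suc y) a = begin
      (u zero ∙ sum (u ∘ suc)) ∙ a    ≈⟨ assoc _ _ _ ⟩
      u zero ∙ (sum (u ∘ suc) ∙ a)    ≈⟨ ∙-congˡ (sum-updateAt (u ∘ suc) y a) ⟩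
      u zero ∙ (u (suc y) ∙ s)        ≈⟨ solve 3 (λ x y s → x ⊕ (y ⊕ s) ⊜ y ⊕ (x ⊕ s)) ≈-refl (u zero) (u (suc y)) s ⟩
      u (suc y) ∙ (u zero ∙ s)        ∎
      where s = sum (updateAt (u ∘ suc) y (const a))

    -- The multiplicities stand on both sides so that no subtraction n ∸ N and
    -- no inverse of a is needed.
    sum-injective : ∀ (b : Fin N → Fin n) → Injective _≡_ _≡_ b → ∀ (u : Fin n → Carrier) a →
                    (∀ x → (∀ i → b i ≢ x) → u x ≈ a) →
                    sum u ∙ N ×ᴹ a ≈ sum (u ∘ b) ∙ n ×ᴹ a
    sum-injective {zero} {n} b inj u a off = begin
      sum u ∙ ε           ≈⟨ identityʳ _ ⟩
      sum u               ≈⟨ sum-cong-≋ (λ x → off x (λ ())) ⟩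
      sum {n} (λ _ → a)   ≈⟨ sum-replicate n ⟩
      n ×ᴹ a              ≈⟨ identityˡ _ ⟨
      ε ∙ n ×ᴹ a          ∎
    sum-injective {suc N} {n} b inj u a off = begin
      sum u ∙ (a ∙ N ×ᴹ a)               ≈⟨ assoc _ _ _ ⟨
      (sum u ∙ a) ∙ N ×ᴹ a               ≈⟨ ∙-congʳ (sum-updateAt u y a) ⟩
      (u y ∙ sum u′) ∙ N ×ᴹ a            ≈⟨ assoc _ _ _ ⟩
      u y ∙ (sum u′ ∙ N ×ᴹ a)            ≈⟨ ∙-congˡ (sum-injective (b ∘ suc) (λ e → suc-injective (inj e)) u′ a off′) ⟩
      u y ∙ (sum (u′ ∘ b ∘ suc) ∙ n ×ᴹ a) ≈⟨ ∙-congˡ (∙-congʳ (sum-cong-≋ (λ i → ≈-reflexive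
                                               (updateAt-minimal (b (suc i)) y u (λ e → contradiction (inj e) (λ ())))))) ⟩
      u y ∙ (sum (u ∘ b ∘ suc) ∙ n ×ᴹ a) ≈⟨ assoc _ _ _ ⟨
      (u y ∙ sum (u ∘ b ∘ suc)) ∙ n ×ᴹ a ∎
      where
      y = b zero
      -- Overwriting the value at `b zero` by `a` makes `b zero` an ordinary point off the image of
      -- `b ∘ suc`, as the induction hypothesis requires.
      u′ = updateAt u y (const a)
      off′ : ∀ x → (∀ i → b (suc i) ≢ x) → u′ x ≈ a
      off′ x h with y ≟ x
      ... | yes refl = ≈-reflexive (updateAt-updates y u)
      ... | no y≢x   = ≈-trans (≈-reflexive (updateAt-minimal x y u (y≢x ∘ sym)))
                               (off x (λ { zero → y≢x ; (suc i) → h i }))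

  ×≡* : ∀ n a → MonoidMult._×_ +-0-monoid n a ≡ n * a
  ×≡* zero    a = refl
  ×≡* (suc n) a = cong (a +_) (×≡* n a)

  ×≡^ : ∀ n a → MonoidMult._×_ *-1-monoid n a ≡ a ^ n
  ×≡^ zero    a = refl
  ×≡^ (suc n) a = cong (a *_) (×≡^ n a)

  ∑Fin-injective : ∀ (b : Fin N → Fin n) → Injective _≡_ _≡_ b → ∀ (u : Fin n → ℕ) a →
                   (∀ x → (∀ i → b i ≢ x) → u x ≡ a) →
                   ∑Fin n u + N * a ≡ ∑Fin N (u ∘ b) + n * a
  ∑Fin-injective {N} {n} b inj u a off = begin
    ∑Fin n u + N * a        ≡⟨ cong₂ _+_ (∑Fin≡sum u) (sym (×≡* N a)) ⟩
    Sum.sum u + N ×⁺ a      ≡⟨ sum-injective +-0-commutativeMonoid b inj u a off ⟩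
    Sum.sum (u ∘ b) + n ×⁺ a ≡⟨ cong₂ _+_ (sym (∑Fin≡sum (u ∘ b))) (×≡* n a) ⟩
    ∑Fin N (u ∘ b) + n * a  ∎
    where
    open ≡-Reasoning
    _×⁺_ = MonoidMult._×_ +-0-monoid

  ∏-injective : ∀ (b : Fin N → Fin n) → Injective _≡_ _≡_ b → ∀ (u : Fin n → ℕ) a →
                (∀ x → (∀ i → b i ≢ x) → u x ≡ a) →
                ∏ u * a ^ N ≡ ∏ (u ∘ b) * a ^ n
  ∏-injective {N} {n} b inj u a off = begin
    ∏ u * a ^ N          ≡⟨ cong (∏ u *_) (×≡^ N a) ⟨
    ∏ u * N ×* a         ≡⟨ sum-injective *-1-commutativeMonoid b inj u a off ⟩
    ∏ (u ∘ b) * n ×* a   ≡⟨ cong (∏ (u ∘ b) *_) (×≡^ n a) ⟩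
    ∏ (u ∘ b) * a ^ n    ∎
    where
    open ≡-Reasoning
    _×*_ = MonoidMult._×_ *-1-monoid

  -- A map G : Fin n → Fin (suc n) is a digraph on Fin (suc n) in which zero is
  -- a root and suc x points to G x; the marked vertices are further roots.
  data Rooted (b : Fin n → Bool) (G : Vec (Fin (suc n)) n) : Fin (suc n) → Set where
    root   : Rooted b G zero
    marked : ∀ {x} → b x ≡ true → Rooted b G (suc x)
    step   : ∀ {x} → Rooted b G (lookup G x) → Rooted b G (suc x)

  AllRooted : (Fin n → Bool) → Vec (Fin (suc n)) n → Set
  AllRooted b G = ∀ y → Rooted b G y

  -- Contraction of vertex one into the vertex j of the remaining graph.
  merge : Fin (suc n) → Fin (suc (suc n)) → Fin (suc n)
  merge j zero          = zero
  merge j (suc zero)    = j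
  merge j (suc (suc i)) = suc i

  -- A section of every `merge j`. It misses only vertex one, so the out-edge of vertex one is
  -- either a loop or `unmerge j` for the `j` into which it is contracted.
  unmerge : Fin (suc n) → Fin (suc (suc n))
  unmerge zero    = zero
  unmerge (suc i) = suc (suc i)

  module _ {b : Fin (suc n) → Bool} {y : Fin (suc (suc n))} {G : Vec (Fin (suc (suc n))) n}
           {j : Fin (suc n)} where

    private
      b′ = b ∘ suc
      G′ = Vec.map (merge j) G

    -- A path through vertex one stands still at `j` for that step; this is the condition
    -- `merge j y ≡ j`. A path that ends at vertex one because it is marked needs `j` to be rooted
    -- already.
    Rooted-merge : (b zero ≡ true → Rooted b′ G′ j) → merge j y ≡ j →
                   ∀ {x} → Rooted b (y ∷ G) x → Rooted b′ G′ (merge j x)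
    Rooted-merge h e root                 = root
    Rooted-merge h e (marked {zero} p)    = h p
    Rooted-merge h e (marked {suc x} p)   = marked p
    Rooted-merge h e (step {zero} r)      = subst (Rooted b′ G′) e (Rooted-merge h e r)
    Rooted-merge h e (step {suc x} r)     =
      step (subst (Rooted b′ G′) (sym (lookup-map x (merge j) G)) (Rooted-merge h e r))

    -- An edge into `j` in the contracted graph may come from an edge into vertex one. Hence the
    -- mutual `preimage`, which treats every vertex over `z`; the hypothesis passes rootedness from
    -- `unmerge j` to vertex one.
    Rooted-unmerge : (Rooted b (y ∷ G) (unmerge j) → Rooted b (y ∷ G) (suc zero)) →
                     ∀ {z} → Rooted b′ G′ z → Rooted b (y ∷ G) (unmerge z)
    preimage : (Rooted b (y ∷ G) (unmerge j) → Rooted b (y ∷ G) (suc zero)) →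
           ∀ {z} → Rooted b′ G′ z → ∀ x → z ≡ merge j x → Rooted b (y ∷ G) x

    Rooted-unmerge h root             = root
    Rooted-unmerge h (marked p)       = marked p
    Rooted-unmerge h (step {x} r)     = step (preimage h r (lookup G x) (lookup-map x (merge j) G))

    preimage h r zero          e    = root
    preimage h r (suc zero)    refl = h (Rooted-unmerge h r)
    preimage h r (suc (suc i)) refl = Rooted-unmerge h r

  module _ {b : Fin (suc n) → Bool} {G : Vec (Fin (suc (suc n))) n} where

    private b′ = b ∘ suc

    AllRooted-marked⁺ : ∀ {y} → b zero ≡ true → AllRooted b (y ∷ G) → AllRooted b′ (Vec.map (merge zero) G)
    AllRooted-marked⁺     p all zero    = root
    AllRooted-marked⁺ {y} p all (suc x) = Rooted-merge (λ _ → root) refl (redirect (all (suc (suc x))))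
      where
      -- With vertex one marked, its out-edge is irrelevant and can be redirected to zero.
      redirect : ∀ {x} → Rooted b (y ∷ G) x → Rooted b (zero ∷ G) x
      redirect root              = root
      redirect (marked q)        = marked q
      redirect (step {zero} r)   = marked p
      redirect (step {suc x} r)  = step (redirect r)

    AllRooted-marked⁻ : ∀ {y} → b zero ≡ true → AllRooted b′ (Vec.map (merge zero) G) → AllRooted b (y ∷ G)
    AllRooted-marked⁻ p all x = preimage (λ _ → marked p) (all (merge zero x)) x refl

    -- Only `step` could root an unmarked vertex with a loop, and its premise is a smaller
    -- derivation for the same vertex.
    AllRooted-loop : b zero ≡ false → ¬ AllRooted b (suc zero ∷ G)
    AllRooted-loop p all = go (all (suc zero)) refl
      where
      go : ∀ {x} → Rooted b (suc zero ∷ G) x → x ≢ suc zero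
      go root       ()
      go (marked q) refl = contradiction (trans (sym p) q) (λ ())
      go (step r)   refl = go r refl

    AllRooted-merge⁺ : ∀ j → b zero ≡ false → AllRooted b (unmerge j ∷ G) → AllRooted b′ (Vec.map (merge j) G)
    AllRooted-merge⁺ j p all z = subst (Rooted _ _) (merge-unmerge z)
      (Rooted-merge (λ q → contradiction (trans (sym p) q) (λ ())) (merge-unmerge j) (all (unmerge z)))
      where
      merge-unmerge : ∀ z → merge j (unmerge z) ≡ z
      merge-unmerge zero    = refl
      merge-unmerge (suc z) = refl

    AllRooted-merge⁻ : ∀ j → AllRooted b′ (Vec.map (merge j) G) → AllRooted b (unmerge j ∷ G)
    AllRooted-merge⁻ j all x = preimage step (all (merge j x)) x refl

  -- Following edges need not terminate, as `G` may have cycles; contraction removes one vertex at a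
  -- time and gives a structural recursion, the same one that evaluates the count.
  allRooted? : ∀ (b : Fin n → Bool) G → Dec (AllRooted b G)
  allRooted? {zero}  b []      = yes λ { zero → root }
  allRooted? {suc n} b (y ∷ G) with b zero in p | y
  ... | true  | _           = map′ (AllRooted-marked⁻ p) (AllRooted-marked⁺ p)
                                   (allRooted? (b ∘ suc) (Vec.map (merge zero) G))
  ... | false | zero        = map′ (AllRooted-merge⁻ zero) (AllRooted-merge⁺ zero p)
                                   (allRooted? (b ∘ suc) (Vec.map (merge zero) G))
  ... | false | suc zero    = no (AllRooted-loop p)
  ... | false | suc (suc i) = map′ (AllRooted-merge⁻ (suc i)) (AllRooted-merge⁺ (suc i) p)
                                   (allRooted? (b ∘ suc) (Vec.map (merge (suc i)) G))

  rootIndicator : (Fin n → Bool) → Fin (suc n) → ℕ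
  rootIndicator b zero    = 1
  rootIndicator b (suc x) = if b x then 1 else 0

  unmarkedCount : (Fin n → Bool) → ℕ
  unmarkedCount b = Sum.sum (λ x → if b x then 0 else 1)

  -- The out-edge of a marked vertex does not influence rootedness and is summed freely, so it
  -- contributes its total weight.
  markedProduct : (Fin n → Bool) → (Fin n → Fin m → ℕ) → ℕ
  markedProduct {m = m} b v = ∏ (λ x → if b x then ∑Fin m (v x) else 1)

  rootWeight : (Fin n → Bool) → (Fin (suc n) → ℕ) → ℕ
  rootWeight {n} b w = ∑Fin (suc n) (λ y → w y * rootIndicator b y)

  markedProduct-push : ∀ (b : Fin n → Bool) (v : Fin n → Fin m → ℕ) {q} (c : Fin m → Fin q) →
                       markedProduct b (push c ∘ v) ≡ markedProduct b v
  markedProduct-push b v c = Prod.sum-cong-≗ λ x →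
    cong (λ t → if b x then t else 1) (∑-push-1 c (v x))

  rootWeight-push : ∀ (b : Fin n → Bool) {m} (w : Fin m → ℕ) (c : Fin m → Fin (suc n)) →
                    rootWeight b (push c w) ≡ ∑Fin m (λ y → w y * rootIndicator b (c y))
  rootWeight-push b w c = ∑-push c w (rootIndicator b)

  ∑Fin-suc² : ∀ (f : Fin (suc (suc n)) → ℕ) → ∑Fin (suc (suc n)) f ≡ f zero + (f (suc zero) + ∑Fin n (λ i → f (suc (suc i))))
  ∑Fin-suc² f = trans (∑Fin-suc f) (cong (f zero +_) (∑Fin-suc (f ∘ suc)))

  module _ (b : Fin (suc n) → Bool) (v : Fin (suc n) → Fin (suc (suc n)) → ℕ) where

    private b′ = b ∘ suc

    contracted : Fin (suc n) → ℕ
    contracted j = ∑ (fun n (suc n)) (λ G → weight (push (merge j) ∘ v ∘ suc) G * 𝟙 (allRooted? b′ G))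

    ∑-contract : ∀ y j →
      (∀ G → 𝟙 (allRooted? b (y ∷ G)) ≡ 𝟙 (allRooted? b′ (Vec.map (merge j) G))) →
      ∑ (fun n (suc (suc n))) (λ G → weight v (y ∷ G) * 𝟙 (allRooted? b (y ∷ G)))
      ≡ v zero y * contracted j
    ∑-contract y j e = begin
      ∑ (fun n _) (λ G → v zero y * weight (v ∘ suc) G * 𝟙 (allRooted? b (y ∷ G)))
        ≡⟨ ∑-cong (fun n _) (λ G → trans (*-assoc (v zero y) _ _)
             (cong (λ t → v zero y * (weight (v ∘ suc) G * t)) (e G))) ⟩
      ∑ (fun n _) (λ G → v zero y * (weight (v ∘ suc) G * 𝟙 (allRooted? b′ (Vec.map (merge j) G))))
        ≡⟨ ∑-*ˡ (fun n _) (v zero y) _ ⟩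
      v zero y * ∑ (fun n _) (λ G → weight (v ∘ suc) G * 𝟙 (allRooted? b′ (Vec.map (merge j) G)))
        ≡⟨ cong (v zero y *_) (∑-fun-push (merge j) (v ∘ suc) (λ G → 𝟙 (allRooted? b′ G))) ⟩
      v zero y * contracted j ∎
      where open ≡-Reasoning

  -- Contracting the first vertex into the one it
  -- points to preserves the total weight of the targets, and adds the weight of
  -- that vertex to the roots exactly if it points to a root.
  ∑-forest : ∀ (b : Fin n → Bool) (v : Fin n → Fin (suc n) → ℕ) (w : Fin (suc n) → ℕ) →
             (∀ x → b x ≡ false → v x ≗ w) →
             ∑ (fun n (suc n)) (λ G → weight v G * 𝟙 (allRooted? b G)) * ∑Fin (suc n) w
             ≡ markedProduct b v * (rootWeight b w * ∑Fin (suc n) w ^ unmarkedCount b)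
  ∑-forest {zero} b v w h with w zero
  ... | a = solve 1 (λ a → con 1 :* (a :+ con 0) := con 1 :* ((a :* con 1 :+ con 0) :* con 1)) refl a
    where open +-*-Solver
  ∑-forest {suc n} b v w h = by-cases (b zero) refl
    where
    open ≡-Reasoning
    b′ = b ∘ suc
    W = ∑Fin (suc (suc n)) w
    M = markedProduct b′ (v ∘ suc)
    U = W ^ unmarkedCount b′
    w₀ = w zero
    w₁ = w (suc zero)
    O = ∑Fin n (λ i → w (suc (suc i)))
    S = ∑Fin n (λ i → w (suc (suc i)) * rootIndicator b′ (suc i))
    T = contracted b v
    total = ∑ (fun (suc n) (suc (suc n))) (λ G → weight v G * 𝟙 (allRooted? b G))

    -- Root weight after contraction into `j`: the weight `w₁` of vertex one moves to `j` and counts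
    -- exactly if `j` is a root.
    r : Fin (suc n) → ℕ
    r j = w₀ * 1 + (w₁ * rootIndicator b′ j + S)

    T*W : ∀ j → T j * W ≡ M * (r j * U)
    T*W j = begin
      T j * W
        ≡⟨ cong (T j *_) W′≡W ⟨
      T j * W′
        ≡⟨ ∑-forest b′ (push (merge j) ∘ v ∘ suc) (push (merge j) w)
             (λ x p → push-cong (merge j) (h (suc x) p)) ⟩
      markedProduct b′ (push (merge j) ∘ v ∘ suc) * (rootWeight b′ (push (merge j) w) * W′ ^ unmarkedCount b′)
        ≡⟨ cong₂ (λ s t → s * (t * W′ ^ unmarkedCount b′)) (markedProduct-push b′ (v ∘ suc) (merge j))
             (trans (rootWeight-push b′ w (merge j)) (∑Fin-suc² (λ y → w y * rootIndicator b′ (merge j y)))) ⟩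
      M * (r j * W′ ^ unmarkedCount b′)
        ≡⟨ cong (λ t → M * (r j * t ^ unmarkedCount b′)) W′≡W ⟩
      M * (r j * U) ∎
      where
      W′ = ∑Fin (suc n) (push (merge j) w)
      W′≡W = ∑-push-1 (merge j) w

    by-cases : ∀ β → b zero ≡ β → total * W ≡ markedProduct b v * (rootWeight b w * W ^ unmarkedCount b)
    -- A marked vertex one is contracted into the root `zero`, so `w₁` stays in the root weight.
    by-cases true p = begin
      total * W
        ≡⟨ cong (_* W) (∑-vecs-suc (allFin (suc (suc n))) n _) ⟩
      ∑Fin _ (λ y → ∑ (fun n _) (λ G → weight v (y ∷ G) * 𝟙 (allRooted? b (y ∷ G)))) * W
        ≡⟨ cong (_* W) (trans (∑-cong (allFin _) (λ y → ∑-contract b v y zero (λ G →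
             𝟙-cong (allRooted? b (y ∷ G)) (allRooted? b′ _) (AllRooted-marked⁺ p) (AllRooted-marked⁻ p))))
             (∑-*ʳ (allFin _) (v zero) (T zero))) ⟩
      V * T zero * W
        ≡⟨ trans (*-assoc V _ _) (cong (V *_) (T*W zero)) ⟩
      V * (M * (r zero * U))
        ≡⟨ *-assoc V M _ ⟨
      V * M * (r zero * U)
        ≡⟨ cong₂ _*_ (cong (λ t → (if t then V else 1) * M) p)
             (cong₂ _*_ (trans (∑Fin-suc² (λ y → w y * rootIndicator b y)) (cong (λ t → w₀ * 1 + (w₁ * (if t then 1 else 0) + S)) p))
                        (cong (λ t → W ^ ((if t then 0 else 1) + unmarkedCount b′)) p)) ⟨
      markedProduct b v * (rootWeight b w * W ^ unmarkedCount b) ∎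
      where V = ∑Fin (suc (suc n)) (v zero)
    by-cases false p = begin
      total * W
        ≡⟨ cong (_* W) (trans (∑-vecs-suc (allFin (suc (suc n))) n _) (∑Fin-suc² branch)) ⟩
      (branch zero + (branch (suc zero) + ∑Fin n (λ i → branch (suc (suc i))))) * W
        ≡⟨ cong (_* W) (cong₂ _+_ (open-branch zero) (cong₂ _+_ closed-branch
             (∑-cong (allFin n) (open-branch ∘ suc)))) ⟩
      (w₀ * T zero + (0 + ∑Fin n (λ i → w (suc (suc i)) * T (suc i)))) * W
        ≡⟨ solve 4 (λ a t s w → (a :* t :+ (con 0 :+ s)) :* w := a :* (t :* w) :+ s :* w) refl w₀ (T zero) _ W ⟩
      w₀ * (T zero * W) + ∑Fin n (λ i → w (suc (suc i)) * T (suc i)) * W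
        ≡⟨ cong₂ _+_ (cong (w₀ *_) (T*W zero)) (trans (sym (∑-*ʳ (allFin n) _ W))
             (∑-cong (allFin n) (λ i → trans (*-assoc (w (suc (suc i))) _ _)
                (trans (cong (w (suc (suc i)) *_) (T*W (suc i))) (split i))))) ⟩
      w₀ * (M * (r zero * U)) + ∑Fin n (λ i → w (suc (suc i)) * (M * (R * U))
          + w (suc (suc i)) * rootIndicator b′ (suc i) * (M * (w₁ * U)))
        ≡⟨ cong (w₀ * (M * (r zero * U)) +_) (trans (∑-+ (allFin n) _ _)
             (cong₂ _+_ (∑-*ʳ (allFin n) _ _) (∑-*ʳ (allFin n) _ _))) ⟩
      w₀ * (M * (r zero * U)) + (O * (M * (R * U)) + S * (M * (w₁ * U)))
        -- Here `R` is `w₀ + S`, the root weight without vertex one. The targets other than the loop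
        -- contribute `R * (w₀ + O)`, and the root targets among them add `w₁ * (w₀ + S)`. The
        -- latter is `w₁ * R`, just what the excluded loop would have contributed, and the sum is
        -- `R * W`.
        ≡⟨ solve 6 (λ a b c s m u →
             a :* (m :* ((a :* con 1 :+ (b :* con 1 :+ s)) :* u)) :+ (c :* (m :* ((a :* con 1 :+ (b :* con 0 :+ s)) :* u)) :+ s :* (m :* (b :* u)))
             := con 1 :* m :* ((a :* con 1 :+ (b :* con 0 :+ s)) :* ((a :+ (b :+ c)) :* u))) refl w₀ w₁ O S M U ⟩
      1 * M * (R * ((w₀ + (w₁ + O)) * U))
        ≡⟨ cong (λ t → 1 * M * (R * (t * U))) (∑Fin-suc² w) ⟨
      1 * M * (R * (W * U))
        ≡⟨ cong₂ _*_ (cong (λ t → (if t then V else 1) * M) p)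
             (cong₂ _*_ (trans (∑Fin-suc² (λ y → w y * rootIndicator b y)) (cong (λ t → w₀ * 1 + (w₁ * (if t then 1 else 0) + S)) p))
                        (cong (λ t → W ^ ((if t then 0 else 1) + unmarkedCount b′)) p)) ⟨
      markedProduct b v * (rootWeight b w * W ^ unmarkedCount b) ∎
      where
      open +-*-Solver
      V = ∑Fin (suc (suc n)) (v zero)
      R = w₀ * 1 + (w₁ * 0 + S)

      branch : Fin (suc (suc n)) → ℕ
      branch y = ∑ (fun n _) (λ G → weight v (y ∷ G) * 𝟙 (allRooted? b (y ∷ G)))

      open-branch : ∀ j → branch (unmerge j) ≡ w (unmerge j) * T j
      open-branch j = trans
        (∑-contract b v (unmerge j) j (λ G →
           𝟙-cong (allRooted? b (unmerge j ∷ G)) (allRooted? b′ _) (AllRooted-merge⁺ j p) (AllRooted-merge⁻ j)))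
        (cong (_* T j) (h zero p (unmerge j)))

      closed-branch : branch (suc zero) ≡ 0
      closed-branch = trans (∑-cong (fun n _) (λ G →
        trans (cong (weight v (suc zero ∷ G) *_) (𝟙-no (allRooted? b (suc zero ∷ G)) (AllRooted-loop p)))
              (*-zeroʳ (weight v (suc zero ∷ G))))) (∑-zero (fun n _))

      split : ∀ i → w (suc (suc i)) * (M * (r (suc i) * U))
                  ≡ w (suc (suc i)) * (M * (R * U)) + w (suc (suc i)) * rootIndicator b′ (suc i) * (M * (w₁ * U))
      split i = solve 7 (λ z m a b ρ s u →
        z :* (m :* ((a :* con 1 :+ (b :* ρ :+ s)) :* u))
        := z :* (m :* ((a :* con 1 :+ (b :* con 0 :+ s)) :* u)) :+ z :* ρ :* (m :* (b :* u)))
        refl (w (suc (suc i))) M w₀ w₁ (rootIndicator b′ (suc i)) S U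

  -- Attracting cycles

  does⇒ : (d : Dec A) → does d ≡ true → A
  does⇒ (yes p) _ = p

  ∣S∣≡∑ : ∀ (S : Subset n) → ∣ S ∣ ≡ ∑Fin n (λ x → 𝟙 (x ∈? S))
  ∣S∣≡∑ [] = refl
  ∣S∣≡∑ {suc n} (s ∷ S) = trans (head-tail s) (sym (trans (∑Fin-suc (λ x → 𝟙 (x ∈? (s ∷ S))))
    (cong (𝟙 (zero ∈? (s ∷ S)) +_) (∑-cong (allFin n) (λ x → 𝟙-cong (suc x ∈? (s ∷ S)) (x ∈? S) drop-there there)))))
    where
    head-tail : ∀ s → ∣ s ∷ S ∣ ≡ 𝟙 (zero ∈? (s ∷ S)) + ∑Fin n (λ x → 𝟙 (x ∈? S))
    head-tail true  = cong suc (∣S∣≡∑ S)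
    head-tail false = ∣S∣≡∑ S

  ≤-sum : ∀ (f : Fin n → ℕ) x → f x ≤ Sum.sum f
  ≤-sum f zero    = m≤m+n _ _
  ≤-sum f (suc x) = ≤-trans (≤-sum (f ∘ suc) x) (m≤n+m _ (f zero))

  toℕ-mod : ∀ m N .{{_ : NonZero N}} → toℕ (m mod N) ≡ m % N
  toℕ-mod m N = toℕ-fromℕ< _

  mod-cong : ∀ m m′ N .{{_ : NonZero N}} → m % N ≡ m′ % N → m mod N ≡ m′ mod N
  mod-cong m m′ N e = toℕ-injective (trans (toℕ-mod m N) (trans e (sym (toℕ-mod m′ N))))

  suc-% : ∀ m N .{{_ : NonZero N}} → suc (m % N) % N ≡ suc m % N
  suc-% m N = trans (%-distribˡ-+ 1 (m % N) N)
    (trans (cong (λ t → (1 % N + t) % N) (m%n%n≡m%n m N)) (sym (%-distribˡ-+ 1 m N)))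

  toℕ-mod-id : ∀ .{{_ : NonZero N}} (i : Fin N) → toℕ i mod N ≡ i
  toℕ-mod-id {N} i = toℕ-injective (trans (toℕ-mod (toℕ i) N) (m<n⇒m%n≡m (toℕ<n i)))

  next : .{{_ : NonZero N}} → Fin N → Fin N
  next {N} i = suc (toℕ i) mod N

  -- `EventuallyCyclic` with the composite replaced by an arbitrary map, so that it can be
  -- transported along pointwise equality of maps.
  CyclicMap : (N : ℕ) .{{_ : NonZero N}} → (Fin n → Fin n) → Set
  CyclicMap N F = ∃ λ S → (∃ λ M → ∀ m → M ≤ m → IsIteratedImage F m S) × ∣ S ∣ ≡ N × ActsAsCycle F N S

  module _ (F : Fin n → Fin n) where

    iterate-+ : ∀ m l x → (F ^∘ (m + l)) x ≡ (F ^∘ m) ((F ^∘ l) x)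
    iterate-+ zero    l x = refl
    iterate-+ (suc m) l x = cong F (iterate-+ m l x)

    iterate-comm : ∀ m l x → (F ^∘ m) ((F ^∘ l) x) ≡ (F ^∘ l) ((F ^∘ m) x)
    iterate-comm m l x = trans (sym (iterate-+ m l x))
      (trans (cong (λ t → (F ^∘ t) x) (+-comm m l)) (iterate-+ l m x))

    iterate-loop : ∀ N {x} → (F ^∘ N) x ≡ x → ∀ t → (F ^∘ (t * N)) x ≡ x
    iterate-loop N e zero    = refl
    iterate-loop N e (suc t) = trans (iterate-+ N (t * N) _)
      (trans (cong (F ^∘ N) (iterate-loop N e t)) e)

    iterate-% : ∀ N .{{_ : NonZero N}} {x} → (F ^∘ N) x ≡ x → ∀ t → (F ^∘ t) x ≡ (F ^∘ (t % N)) x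
    iterate-% N {x} e t = trans (cong (λ s → (F ^∘ s) x) (m≡m%n+[m/n]*n t N))
      (trans (iterate-+ (t % N) (t / N * N) x) (cong (F ^∘ (t % N)) (iterate-loop N e (t / N))))

    orbit : ∀ N → Fin n → Fin N → Fin n
    orbit N x i = (F ^∘ toℕ i) x

    Attracts : (Fin N → Fin n) → Set
    Attracts a = ∀ z → ∃ λ m → ∃ λ i → a i ≡ (F ^∘ m) z

    -- An enumeration in cyclic order is the orbit of its starting point. This pointed form can be
    -- shifted along the cycle, which identifies the possible starting points with all elements of
    -- the stable image.
    record CyclePoint (N : ℕ) (x : Fin n) : Set where
      field
        period    : (F ^∘ N) x ≡ x
        injective : Injective _≡_ _≡_ (orbit N x)
        attracts  : Attracts (orbit N x)

    -- Stabilisation of the iterated images is replaced by the condition that each orbit meets the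
    -- cycle, a reachability statement that fits rooted forests.
    record AttractingCycle .{{_ : NonZero N}} (a : Fin N → Fin n) : Set where
      field
        injective : Injective _≡_ _≡_ a
        steps     : ∀ i → F (a i) ≡ a (next i)
        attracts  : Attracts a

    module _ {a : Fin (suc N) → Fin n} (steps : ∀ i → F (a i) ≡ a (next i)) where

      steps-iterate : ∀ t → (F ^∘ t) (a zero) ≡ a (t mod suc N)
      steps-iterate zero    = cong a refl
      steps-iterate (suc t) = trans (cong F (steps-iterate t)) (trans (steps (t mod suc N))
        (cong a (mod-cong (suc (toℕ (t mod suc N))) (suc t) (suc N) (trans (cong (λ s → suc s % suc N) (toℕ-mod t (suc N))) (suc-% t (suc N))))))

      steps-orbit : ∀ i → orbit (suc N) (a zero) i ≡ a i
      steps-orbit i = trans (steps-iterate (toℕ i)) (cong a (toℕ-mod-id i))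

    attractingCycle⇒point : ∀ {a : Fin (suc N) → Fin n} → AttractingCycle a → CyclePoint (suc N) (a zero)
    attractingCycle⇒point {N} {a} h = record
      { period    = trans (steps-iterate steps (suc N)) (cong a (mod-cong (suc N) 0 (suc N) (n%n≡0 (suc N))))
      ; injective = λ {i} {j} e → injective (trans (sym (steps-orbit steps i)) (trans e (steps-orbit steps j)))
      ; attracts  = λ z → let m , i , e = attracts z in m , i , trans (steps-orbit steps i) e
      }
      where open AttractingCycle h

    point⇒attractingCycle : ∀ {x} → CyclePoint (suc N) x → AttractingCycle (orbit (suc N) x)
    point⇒attractingCycle {N} {x} h = record
      { injective = injective
      ; steps     = λ i → trans (iterate-% (suc N) period (suc (toℕ i)))
                                (cong (λ t → (F ^∘ t) x) (sym (toℕ-mod (suc (toℕ i)) (suc N))))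
      ; attracts  = attracts
      }
      where open CyclePoint h

    CyclePoint-step : ∀ {x} → CyclePoint (suc N) x → CyclePoint (suc N) (F x)
    CyclePoint-step {N} {x} h = record
      { period    = cong F period-shifted
      ; injective = λ {i} {j} e → injective (trans (sym (rewind (toℕ i))) (trans (cong (F ^∘ N) e) (rewind (toℕ j))))
      ; attracts  = λ z → let m , i , e = attracts z in
          suc m , i , trans (iterate-comm (toℕ i) 1 x) (cong F e)
      }
      where
      open CyclePoint h
      period-shifted : (F ^∘ N) (F x) ≡ x
      period-shifted = trans (iterate-comm N 1 x) period
      -- From `F x`, a further `N` steps complete the period `suc N`; they undo the shift, so
      -- injectivity pulls back to the orbit of `x`.
      rewind : ∀ t → (F ^∘ N) ((F ^∘ t) (F x)) ≡ (F ^∘ t) x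
      rewind t = trans (iterate-comm N t (F x)) (cong (F ^∘ t) period-shifted)

    CyclePoint-iterate : ∀ {x} t → CyclePoint (suc N) x → CyclePoint (suc N) ((F ^∘ t) x)
    CyclePoint-iterate zero    h = h
    CyclePoint-iterate (suc t) h = CyclePoint-step (CyclePoint-iterate t h)

    module _ {S : Subset n} {M : ℕ} (image : ∀ m → M ≤ m → IsIteratedImage F m S) where

      ∈⇒cyclePoint : ActsAsCycle F (suc N) S → ∀ {x} → x ∈ S → CyclePoint (suc N) x
      ∈⇒cyclePoint {N} (a , inj , onto , steps) {x} x∈S =
        let j , e = ⇒ (onto x) x∈S in
        subst (CyclePoint (suc N)) (trans (steps-orbit steps j) e)
          (CyclePoint-iterate (toℕ j) (attractingCycle⇒point record
            { injective = inj
            ; steps     = steps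
            ; attracts  = λ z → M , ⇒ (onto _) (⇐ (image M ≤-refl _) (z , refl))
            }))

      -- After `M` full periods `x` is its own image, and `M * suc N` is at least `M`, so the stable
      -- range applies.
      cyclePoint⇒∈ : ∀ {x} → CyclePoint (suc N) x → x ∈ S
      cyclePoint⇒∈ {N} {x} h = ⇐ (image (M * suc N) (m≤m*n M (suc N)) x)
        (x , iterate-loop (suc N) (CyclePoint.period h) M)

    cyclePoint⇒cyclicMap : ∀ {x} → CyclePoint (suc N) x → CyclicMap (suc N) F
    cyclePoint⇒cyclicMap {N} {x} h = S , (M , stable) , card , a , injective , ∈S , steps
      where
      open CyclePoint h
      open AttractingCycle (point⇒attractingCycle h) using (steps)
      a = orbit (suc N) x
      onOrbit? : ∀ y → Dec (∃ λ i → a i ≡ y)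
      onOrbit? y = any? (λ i → a i ≟ y)
      S = tabulate (does ∘ onOrbit?)
      ∈S : ∀ y → y ∈ S ⇔ (∃ λ i → a i ≡ y)
      ∈S y = mk⇔ (λ y∈S → does⇒ (onOrbit? y) (trans (sym (lookup∘tabulate _ y)) ([]=⇒lookup y∈S)))
                 (λ e → lookup⇒[]= y S (trans (lookup∘tabulate _ y) (dec-true (onOrbit? y) e)))
      on-orbit : ∀ t → ∃ λ i → a i ≡ (F ^∘ t) x
      on-orbit t = t mod suc N , trans (cong (λ s → (F ^∘ s) x) (toℕ-mod t (suc N))) (sym (iterate-% (suc N) period t))
      time = λ z → proj₁ (attracts z)
      -- The sum of the hitting times serves as a common upper bound in place of their maximum.
      M = Sum.sum time
      stable : ∀ m → M ≤ m → IsIteratedImage F m S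
      stable m M≤m y = mk⇔ to from
        where
        to : y ∈ S → ∃ λ z → (F ^∘ m) z ≡ y
        to y∈S with ⇒ (∈S y) y∈S
        -- The `m * suc N ∸ m` steps fill up the `m` steps of `F ^∘ m` to `m` full periods; only the
        -- `toℕ i` steps leading to `y` remain.
        ... | i , refl = (F ^∘ (toℕ i + (m * suc N ∸ m))) x , (begin
          (F ^∘ m) ((F ^∘ (toℕ i + (m * suc N ∸ m))) x)
            ≡⟨ cong (F ^∘ m) (iterate-+ (toℕ i) _ x) ⟩
          (F ^∘ m) ((F ^∘ toℕ i) ((F ^∘ (m * suc N ∸ m)) x))
            ≡⟨ iterate-comm m (toℕ i) _ ⟩
          (F ^∘ toℕ i) ((F ^∘ m) ((F ^∘ (m * suc N ∸ m)) x))
            ≡⟨ cong (F ^∘ toℕ i) (trans (sym (iterate-+ m _ x))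
                 (cong (λ t → (F ^∘ t) x) (m+[n∸m]≡n (m≤m*n m (suc N))))) ⟩
          (F ^∘ toℕ i) ((F ^∘ (m * suc N)) x)
            ≡⟨ cong (F ^∘ toℕ i) (iterate-loop (suc N) period m) ⟩
          (F ^∘ toℕ i) x ∎)
          where open ≡-Reasoning
        from : (∃ λ z → (F ^∘ m) z ≡ y) → y ∈ S
        from (z , refl) with attracts z | ≤-sum time z
        ... | t , i , e | t≤M = ⇐ (∈S _)
          (let j , e′ = on-orbit (m ∸ t + toℕ i) in j , trans e′ (begin
            (F ^∘ (m ∸ t + toℕ i)) x        ≡⟨ iterate-+ (m ∸ t) (toℕ i) x ⟩
            (F ^∘ (m ∸ t)) (a i)            ≡⟨ cong (F ^∘ (m ∸ t)) e ⟩
            (F ^∘ (m ∸ t)) ((F ^∘ t) z)     ≡⟨ iterate-+ (m ∸ t) t z ⟨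
            (F ^∘ (m ∸ t + t)) z            ≡⟨ cong (λ s → (F ^∘ s) z) (m∸n+n≡m (≤-trans t≤M M≤m)) ⟩
            (F ^∘ m) z                      ∎))
          where open ≡-Reasoning
      card : ∣ S ∣ ≡ suc N
      card = begin
        ∣ S ∣                                         ≡⟨ ∣S∣≡∑ S ⟩
        ∑Fin n (λ y → 𝟙 (y ∈? S))                     ≡⟨ +-identityʳ _ ⟨
        ∑Fin n (λ y → 𝟙 (y ∈? S)) + 0                 ≡⟨ cong (∑Fin n (λ y → 𝟙 (y ∈? S)) +_) (*-zeroʳ (suc N)) ⟨
        ∑Fin n (λ y → 𝟙 (y ∈? S)) + suc N * 0         ≡⟨ ∑Fin-injective a injective _ 0 (λ y off →
                                                           𝟙-no (y ∈? S) (λ y∈S → let i , e = ⇒ (∈S y) y∈S in off i e)) ⟩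
        ∑Fin (suc N) (λ i → 𝟙 (a i ∈? S)) + n * 0     ≡⟨ cong₂ _+_ (∑-cong (allFin (suc N)) (λ i →
                                                           𝟙-yes (a i ∈? S) (⇐ (∈S (a i)) (i , refl)))) (*-zeroʳ n) ⟩
        ∑Fin (suc N) (λ _ → 1) + 0                    ≡⟨ trans (+-identityʳ _) (trans (∑Fin-const (suc N) 1) (*-identityʳ _)) ⟩
        suc N ∎
        where open ≡-Reasoning

  -- Attracting cycles as rooted forests

  marks : Vec (Fin n) N → Fin n → Bool
  marks a x = does (any? λ i → lookup a i ≟ x)

  module _ (a : Vec (Fin n) N) (F : Vec (Fin n) n) where

    private
      G = Vec.map Fin.suc F

    -- The number of `step`s needed matches the time to reach the cycle. No edge of `G` leads to the
    -- extra root `zero`; it is there for the contraction of the cycle points.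
    attracts⇒allRooted : Attracts (lookup F) (lookup a) → AllRooted (marks a) G
    attracts⇒allRooted h zero    = root
    attracts⇒allRooted h (suc z) = let m , i , e = h z in go m z (i , e)
      where
      go : ∀ m z → (∃ λ i → lookup a i ≡ (lookup F ^∘ m) z) → Rooted (marks a) G (suc z)
      go zero    z e       = marked (dec-true (any? λ i → lookup a i ≟ z) e)
      go (suc m) z (i , e) = step (subst (Rooted _ _) (sym (lookup-map z suc F))
        (go m (lookup F z) (i , trans e (iterate-comm (lookup F) 1 m z))))

    allRooted⇒attracts : AllRooted (marks a) G → Attracts (lookup F) (lookup a)
    allRooted⇒attracts h z = go (h (suc z)) refl
      where
      go : ∀ {y z} → Rooted (marks a) G y → y ≡ suc z → ∃ λ m → ∃ λ i → lookup a i ≡ (lookup F ^∘ m) z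
      go {z = z} (marked p) refl = 0 , does⇒ (any? λ i → lookup a i ≟ z) p
      go {z = z} (step r)   refl =
        let m , i , e = go r (lookup-map z suc F)
        in suc m , i , trans e (iterate-comm (lookup F) m 1 z)

  injective? : ∀ (a : Fin N → Fin n) → Dec (Injective _≡_ _≡_ a)
  injective? a = map′ (λ h {i} {j} → h i j) (λ h i j → h {i} {j})
    (all? λ i → all? λ j → (a i ≟ a j) →-dec (i ≟ j))

  steps? : ∀ .{{_ : NonZero N}} (a : Vec (Fin n) N) (F : Vec (Fin n) n) →
           Dec (∀ i → lookup F (lookup a i) ≡ lookup a (next i))
  steps? a F = all? λ i → lookup F (lookup a i) ≟ lookup a (next i)

  attractingCycle? : ∀ .{{_ : NonZero N}} (a : Vec (Fin n) N) F → Dec (AttractingCycle (lookup F) (lookup a))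
  attractingCycle? a F = map′
    (λ (i , s , r) → record { injective = λ {x} {y} → i {x} {y} ; steps = s ; attracts = allRooted⇒attracts a F r })
    (λ h → let open AttractingCycle h in (λ {x} {y} → injective {x} {y}) , steps , attracts⇒allRooted a F attracts)
    (injective? (lookup a) ×-dec steps? a F ×-dec allRooted? (marks a) (Vec.map suc F))

  -- The N starting points of the cycle give its N enumerations in cyclic order.
  ∑-attractingCycle : ∀ (F : Vec (Fin n) n) (d : Dec (CyclicMap (suc N) (lookup F))) →
                      ∑ (fun (suc N) n) (λ a → 𝟙 (attractingCycle? a F)) ≡ suc N * 𝟙 d
  ∑-attractingCycle {n} {N} F (no ¬c) = trans
    (∑-cong (fun (suc N) n) (λ a → 𝟙-no (attractingCycle? a F)
      (¬c ∘ cyclePoint⇒cyclicMap (lookup F) ∘ attractingCycle⇒point (lookup F))))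
    (trans (∑-zero (fun (suc N) n)) (sym (*-zeroʳ (suc N))))
  ∑-attractingCycle {n} {N} F (yes (S , (M , image) , card , acts)) = begin
    ∑ (fun (suc N) n) (λ a → 𝟙 (attractingCycle? a F))
      ≡⟨ ∑-vecs-suc (allFin n) N _ ⟩
    ∑Fin n (λ x → ∑ (fun N n) (λ a → 𝟙 (attractingCycle? (x ∷ a) F)))
      ≡⟨ ∑-cong (allFin n) (λ x → begin
           ∑ (fun N n) (λ a → 𝟙 (attractingCycle? (x ∷ a) F))
             ≡⟨ ∑-cong (fun N n) (λ a →
                  𝟙-× (attractingCycle? (x ∷ a) F) (tail x ≟ᵛ a) (x ∈? S) (to x a) (from x a)) ⟩
           ∑ (fun N n) (λ a → 𝟙 (tail x ≟ᵛ a) * 𝟙 (x ∈? S))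
             ≡⟨ ∑-fun-δ (tail x) (λ _ → 𝟙 (x ∈? S)) ⟩
           𝟙 (x ∈? S) ∎) ⟩
    ∑Fin n (λ x → 𝟙 (x ∈? S))
      ≡⟨ trans (sym (∣S∣≡∑ S)) card ⟩
    suc N
      ≡⟨ *-identityʳ (suc N) ⟨
    suc N * 1 ∎
    where
    open ≡-Reasoning
    f = lookup F
    tail : Fin n → Vec (Fin n) N
    tail x = tabulate (orbit f (suc N) x ∘ suc)
    to : ∀ x a → AttractingCycle f (lookup (x ∷ a)) → tail x ≡ a × x ∈ S
    to x a h = trans (tabulate-cong (steps-orbit f (AttractingCycle.steps h) ∘ suc)) (tabulate∘lookup a) ,
               cyclePoint⇒∈ f {M = M} image (attractingCycle⇒point f h)
    from : ∀ x a → tail x ≡ a → x ∈ S → AttractingCycle f (lookup (x ∷ a))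
    from x a refl x∈S = record
      { injective = λ {i} {j} e → injective (trans (sym (e′ i)) (trans e (e′ j)))
      ; steps     = λ i → trans (cong f (e′ i)) (trans (steps i) (sym (e′ (next i))))
      ; attracts  = λ z → let m , i , e = attracts z in m , i , trans (e′ i) e
      }
      where
      open AttractingCycle (point⇒attractingCycle f (∈⇒cyclePoint f {M = M} image acts x∈S))
      e′ : lookup (x ∷ tail x) ≗ orbit f (suc N) x
      e′ = lookup∘tabulate (orbit f (suc N) x)

  -- Summation over tuples of maps

  𝟙-∏ : ∀ {P : Fin n → Set} {Q : Set} (e : Dec Q) (d : ∀ x → Dec (P x)) →
        (Q → ∀ x → P x) → ((∀ x → P x) → Q) → 𝟙 e ≡ ∏ (𝟙 ∘ d)
  𝟙-∏ {zero}  e d f g = 𝟙-yes e (g λ ())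
  𝟙-∏ {suc n} e d f g = trans
    (𝟙-× e (d zero) (all? (d ∘ suc)) (λ q → f q zero , f q ∘ suc)
         (λ p ps → g λ { zero → p ; (suc x) → ps x }))
    (cong (𝟙 (d zero) *_) (𝟙-∏ (all? (d ∘ suc)) (d ∘ suc) id id))

  ∏-1 : ∀ {u : Fin n → ℕ} → (∀ x → u x ≡ 1) → ∏ u ≡ 1
  ∏-1 {zero}  e = refl
  ∏-1 {suc n} e = trans (cong₂ _*_ (e zero) (∏-1 (e ∘ suc))) refl

  hit? : ∀ (b : Vec (Fin n) N) x → Dec (∃ λ i → lookup b i ≡ x)
  hit? b x = any? λ i → lookup b i ≟ x

  -- The condition imposed at x by the prescription F (b i) ≡ c i.
  module _ (b : Vec (Fin n) N) (c : Fin N → Fin m) where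

    pin? : ∀ x y → Dec (∀ i → lookup b i ≡ x → y ≡ c i)
    pin? x y = all? λ i → (lookup b i ≟ x) →-dec (y ≟ c i)

    pin : Fin n → Fin m → ℕ
    pin x y = 𝟙 (pin? x y)

    weight-pin : ∀ F (d : Dec (∀ i → lookup F (lookup b i) ≡ c i)) → weight pin F ≡ 𝟙 d
    weight-pin F d = sym (𝟙-∏ d (λ x → pin? x (lookup F x))
      (λ { h x i refl → h i }) (λ h i → h (lookup b i) i refl))

    pin-free : ∀ {x} y → (∀ i → lookup b i ≢ x) → pin x y ≡ 1
    pin-free {x} y off = 𝟙-yes (pin? x y) (λ i e → contradiction e (off i))

    -- Injectivity leaves a single prescription at `lookup b i`; two conflicting ones would make the
    -- sum vanish.
    ∑-pin : Injective _≡_ _≡_ (lookup b) → ∀ i (w : Fin m → ℕ) →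
            ∑Fin m (λ y → w y * pin (lookup b i) y) ≡ w (c i)
    ∑-pin inj i w = trans (∑-cong (allFin m) (λ y → trans (*-comm (w y) _) (cong (_* w y)
      (𝟙-cong (pin? (lookup b i) y) (c i ≟ y) (λ h → sym (h i refl))
         (λ { refl j e → cong c (sym (inj e)) })))))
      (∑Fin-δ (c i) w)

  -- The values prescribed at the cycle points are the cycle points themselves, rotated by one
  -- place; a product does not see the rotation.
  ∏-next : ∀ (u : Fin (suc N) → ℕ) → ∏ (u ∘ next) ≡ ∏ u
  ∏-next {N} u = begin
    ∏ (u ∘ next)                                        ≡⟨ Prod.sum-init-last (u ∘ next) ⟩
    ∏ (u ∘ next ∘ inject₁) * u (next (fromℕ N))         ≡⟨ cong₂ _*_ (Prod.sum-cong-≗ (cong u ∘ next-inject₁))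
                                                                       (cong u next-fromℕ) ⟩
    ∏ (u ∘ suc) * u zero                                ≡⟨ *-comm _ (u zero) ⟩
    ∏ u ∎
    where
    open ≡-Reasoning
    next-inject₁ : ∀ i → next (inject₁ i) ≡ suc i
    next-inject₁ i = toℕ-injective (trans (toℕ-mod (suc (toℕ (inject₁ i))) (suc N))
      (trans (cong (λ t → suc t % suc N) (toℕ-inject₁ i)) (m<n⇒m%n≡m (s≤s (toℕ<n i)))))
    next-fromℕ : next (fromℕ N) ≡ zero
    next-fromℕ = toℕ-injective (trans (toℕ-mod (suc (toℕ (fromℕ N))) (suc N))
      (trans (cong (λ t → suc t % suc N) (toℕ-fromℕ N)) (n%n≡0 (suc N))))

  marks-off : ∀ (a : Vec (Fin n) N) {x} → marks a x ≡ false → ∀ i → lookup a i ≢ x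
  marks-off a {x} p i e = contradiction (trans (sym p) (dec-true (hit? a x) (i , e))) (λ ())

  if-does : ∀ {P : Set} (d : Dec P) → (if does d then 1 else 0) ≡ 𝟙 d
  if-does (yes _) = refl
  if-does (no _)  = refl

  unmarkedCount-marks : ∀ (a : Vec (Fin n) N) → Injective _≡_ _≡_ (lookup a) → unmarkedCount (marks a) + N ≡ n
  unmarkedCount-marks {n} {N} a inj = begin
    unmarkedCount (marks a) + N                    ≡⟨ cong₂ _+_ (∑Fin≡sum unmarked) (*-identityʳ N) ⟨
    ∑Fin n unmarked + N * 1                        ≡⟨ ∑Fin-injective (lookup a) inj unmarked 1 (λ x off →
        cong (λ t → if t then 0 else 1) (dec-false (hit? a x) (λ (i , e) → off i e))) ⟩
    ∑Fin N (unmarked ∘ lookup a) + n * 1           ≡⟨ cong₂ _+_ (trans (∑-cong (allFin N) (λ i →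
        cong (λ t → if t then 0 else 1) (dec-true (hit? a (lookup a i)) (i , refl)))) (∑-zero (allFin N))) (*-identityʳ n) ⟩
    n ∎
    where
    open ≡-Reasoning
    unmarked : Fin n → ℕ
    unmarked x = if marks a x then 0 else 1

  -- The forest count with the cycle points marked. Their out-edges are pinned to the next cycle
  -- point, so each contributes the weight of one target instead of a total weight. The factor
  -- `W * W ^ suc N` clears W^(n-N-2), whose exponent is -1 if the cycle fills the whole set.
  ∑-attracted : ∀ (a : Vec (Fin n) (suc N)) (w : Fin n → ℕ) → let W = ∑Fin n w in
    ∑ (fun n n) (λ F → weight (λ _ → w) F * 𝟙 (attractingCycle? a F)) * (W * W ^ suc N)
    ≡ weight (λ _ → w) a * (𝟙 (injective? (lookup a)) * ∑Fin n (λ z → w z * 𝟙 (hit? a z))) * W ^ n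
  ∑-attracted {n} {N} a w = by-cases (injective? (lookup a))
    where
    open ≡-Reasoning
    W = ∑Fin n w
    b = marks a
    R = ∑Fin n (λ z → w z * 𝟙 (hit? a z))

    by-cases : (d : Dec (Injective _≡_ _≡_ (lookup a))) →
      ∑ (fun n n) (λ F → weight (λ _ → w) F * 𝟙 (attractingCycle? a F)) * (W * W ^ suc N)
      ≡ weight (λ _ → w) a * (𝟙 d * R) * W ^ n
    by-cases (no ¬inj) = begin
      ∑ (fun n n) (λ F → weight (λ _ → w) F * 𝟙 (attractingCycle? a F)) * (W * W ^ suc N)
        ≡⟨ cong (_* (W * W ^ suc N)) (trans (∑-cong (fun n n) (λ F → trans
             (cong (weight (λ _ → w) F *_) (𝟙-no (attractingCycle? a F) (λ h → ¬inj (AttractingCycle.injective h))))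
             (*-zeroʳ (weight (λ _ → w) F)))) (∑-zero (fun n n))) ⟩
      0
        ≡⟨ cong (_* W ^ n) (*-zeroʳ (weight (λ _ → w) a)) ⟨
      weight (λ _ → w) a * 0 * W ^ n ∎
    by-cases (yes inj) = begin
      ∑ (fun n n) (λ F → weight (λ _ → w) F * 𝟙 (attractingCycle? a F)) * (W * W ^ suc N)
        ≡⟨ cong (_* (W * W ^ suc N)) (∑-cong (fun n n) factor) ⟩
      ∑ (fun n n) (λ F → weight v F * 𝟙 (allRooted? b (Vec.map suc F))) * (W * W ^ suc N)
        ≡⟨ cong (_* (W * W ^ suc N)) (∑-fun-push suc v (λ G → 𝟙 (allRooted? b G))) ⟩
      T * (W * W ^ suc N)
        ≡⟨ *-assoc T W _ ⟨
      T * W * W ^ suc N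
        ≡⟨ cong (λ t → T * t * W ^ suc N) W⁺≡W ⟨
      T * W⁺ * W ^ suc N
        ≡⟨ cong (_* W ^ suc N) (∑-forest b (push suc ∘ v) (push suc w) (λ x p →
             push-cong suc (λ y → trans (cong (w y *_) (pin-free a (lookup a ∘ next) y (marks-off a p))) (*-identityʳ (w y))))) ⟩
      markedProduct b (push suc ∘ v) * (rootWeight b (push suc w) * W⁺ ^ unmarkedCount b) * W ^ suc N
        ≡⟨ cong₂ (λ s t → s * (t * W⁺ ^ unmarkedCount b) * W ^ suc N) product
             (trans (rootWeight-push b w suc) (∑-cong (allFin n) (λ z → cong (w z *_) (if-does (hit? a z))))) ⟩
      weight (λ _ → w) a * (R * W⁺ ^ unmarkedCount b) * W ^ suc N
        ≡⟨ cong (λ t → weight (λ _ → w) a * (R * t ^ unmarkedCount b) * W ^ suc N) W⁺≡W ⟩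
      weight (λ _ → w) a * (R * W ^ unmarkedCount b) * W ^ suc N
        ≡⟨ solve 4 (λ p r s t → p :* (r :* s) :* t := p :* (con 1 :* r) :* (s :* t)) refl
             (weight (λ _ → w) a) R (W ^ unmarkedCount b) (W ^ suc N) ⟩
      weight (λ _ → w) a * (1 * R) * (W ^ unmarkedCount b * W ^ suc N)
        ≡⟨ cong (weight (λ _ → w) a * (1 * R) *_) (trans (sym (^-distribˡ-+-* W (unmarkedCount b) (suc N)))
             (cong (W ^_) (unmarkedCount-marks a inj))) ⟩
      weight (λ _ → w) a * (1 * R) * W ^ n ∎
      where
      open +-*-Solver
      c = lookup a ∘ next
      -- Off the cycle `pin` is 1, so `v x` reduces to `w` at unmarked vertices, as `∑-forest`
      -- demands.
      v : Fin n → Fin n → ℕ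
      v x y = w y * pin a c x y
      T = ∑ (fun n (suc n)) (λ G → weight (push suc ∘ v) G * 𝟙 (allRooted? b G))
      W⁺ = ∑Fin (suc n) (push suc w)
      W⁺≡W : W⁺ ≡ W
      W⁺≡W = ∑-push-1 suc w

      factor : ∀ F → weight (λ _ → w) F * 𝟙 (attractingCycle? a F)
                   ≡ weight v F * 𝟙 (allRooted? b (Vec.map suc F))
      factor F = begin
        weight (λ _ → w) F * 𝟙 (attractingCycle? a F)
          ≡⟨ cong (weight (λ _ → w) F *_) (𝟙-× (attractingCycle? a F) (steps? a F) (allRooted? b (Vec.map suc F))
               (λ h → let open AttractingCycle h in steps , attracts⇒allRooted a F attracts)
               (λ s r → record { injective = inj ; steps = s ; attracts = allRooted⇒attracts a F r })) ⟩
        weight (λ _ → w) F * (𝟙 (steps? a F) * 𝟙 (allRooted? b (Vec.map suc F)))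
          ≡⟨ *-assoc (weight (λ _ → w) F) _ _ ⟨
        weight (λ _ → w) F * 𝟙 (steps? a F) * 𝟙 (allRooted? b (Vec.map suc F))
          ≡⟨ cong (λ t → weight (λ _ → w) F * t * 𝟙 (allRooted? b (Vec.map suc F))) (weight-pin a c F (steps? a F)) ⟨
        weight (λ _ → w) F * weight (pin a c) F * 𝟙 (allRooted? b (Vec.map suc F))
          ≡⟨ cong (_* 𝟙 (allRooted? b (Vec.map suc F))) (weight-* (λ _ → w) (pin a c) F) ⟨
        weight v F * 𝟙 (allRooted? b (Vec.map suc F)) ∎

      product : markedProduct b (push suc ∘ v) ≡ weight (λ _ → w) a
      product = begin
        markedProduct b (push suc ∘ v)
          ≡⟨ markedProduct-push b v suc ⟩
        markedProduct b v
          ≡⟨ *-identityʳ _ ⟨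
        markedProduct b v * 1
          ≡⟨ cong (markedProduct b v *_) (^-zeroˡ (suc N)) ⟨
        markedProduct b v * 1 ^ suc N
          ≡⟨ ∏-injective (lookup a) inj _ 1 (λ x off →
               cong (λ t → if t then ∑Fin n (v x) else 1) (dec-false (hit? a x) (λ (i , e) → off i e))) ⟩
        ∏ (λ i → if b (lookup a i) then ∑Fin n (v (lookup a i)) else 1) * 1 ^ n
          ≡⟨ cong₂ _*_ (Prod.sum-cong-≗ (λ i → trans
               (cong (λ t → if t then ∑Fin n (v (lookup a i)) else 1) (dec-true (hit? a (lookup a i)) (i , refl)))
               (∑-pin a c inj i w))) (^-zeroˡ n) ⟩
        ∏ (w ∘ lookup a ∘ next) * 1
          ≡⟨ trans (*-identityʳ _) (∏-next (w ∘ lookup a)) ⟩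
        weight (λ _ → w) a ∎

  -- Injections and points kept distinct

  inj# : Vec (Fin n) N → ℕ
  inj# b = 𝟙 (injective? (lookup b))

  injections : ℕ → ℕ → ℕ
  injections N n = ∑ (fun N n) inj#

  -- A further point either hits a distinct family or extends it to a longer one. This dichotomy
  -- underlies both the recursion for `injections` and the passage to the complement in
  -- `absorbed+separated`.
  inj#-∷ : ∀ (b : Vec (Fin n) N) y → inj# b * 𝟙 (hit? b y) + inj# (y ∷ b) ≡ inj# b
  inj#-∷ b y with injective? (lookup b) | hit? b y | injective? (lookup (y ∷ b))
  ... | yes inj | yes (i , e) | yes inj′ = contradiction (inj′ {zero} {suc i} (sym e)) (λ ())
  ... | yes inj | yes h       | no _     = refl
  ... | yes inj | no ¬h       | yes _    = refl
  ... | yes inj | no ¬h       | no ¬inj′ = contradiction (λ {i} {j} → both i j) ¬inj′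
    where
    both : ∀ i j → lookup (y ∷ b) i ≡ lookup (y ∷ b) j → i ≡ j
    both zero    zero    e = refl
    both zero    (suc j) e = contradiction (j , sym e) ¬h
    both (suc i) zero    e = contradiction (i , e) ¬h
    both (suc i) (suc j) e = cong suc (inj e)
  ... | no ¬inj | _           | yes inj′ = contradiction (λ {i} {j} e → suc-injective (inj′ e)) ¬inj
  ... | no ¬inj | _           | no _     = refl

  ∑-hit : ∀ (b : Vec (Fin n) N) → Injective _≡_ _≡_ (lookup b) → ∑Fin n (λ y → 𝟙 (hit? b y)) ≡ N
  ∑-hit {n} {N} b inj = begin
    ∑Fin n u                        ≡⟨ +-identityʳ _ ⟨
    ∑Fin n u + 0                    ≡⟨ cong (∑Fin n u +_) (*-zeroʳ N) ⟨
    ∑Fin n u + N * 0                ≡⟨ ∑Fin-injective (lookup b) inj u 0 (λ y off → 𝟙-no (hit? b y) (λ (i , e) → off i e)) ⟩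
    ∑Fin N (u ∘ lookup b) + n * 0   ≡⟨ cong₂ _+_ (∑-cong (allFin N) (λ i → 𝟙-yes (hit? b (lookup b i)) (i , refl))) (*-zeroʳ n) ⟩
    ∑Fin N (λ _ → 1) + 0            ≡⟨ trans (+-identityʳ _) (trans (∑Fin-const N 1) (*-identityʳ N)) ⟩
    N ∎
    where
    open ≡-Reasoning
    u = λ y → 𝟙 (hit? b y)

  -- The recursion I(N+1) = (n-N) I(N) of the falling factorial, in additive form to avoid truncated
  -- subtraction.
  injections-suc : ∀ N n → injections (suc N) n + N * injections N n ≡ n * injections N n
  injections-suc N n = begin
    injections (suc N) n + N * injections N n
      ≡⟨ cong₂ _+_ (trans (∑-vecs-suc (allFin n) N inj#) (∑-swap (allFin n) (fun N n) _)) (sym (∑-*ˡ (fun N n) N inj#)) ⟩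
    ∑ (fun N n) (λ b → ∑Fin n (λ y → inj# (y ∷ b))) + ∑ (fun N n) (λ b → N * inj# b)
      ≡⟨ ∑-+ (fun N n) _ _ ⟨
    ∑ (fun N n) (λ b → ∑Fin n (λ y → inj# (y ∷ b)) + N * inj# b)
      ≡⟨ ∑-cong (fun N n) (λ b → begin
           ∑Fin n (λ y → inj# (y ∷ b)) + N * inj# b
             ≡⟨ cong (∑Fin n (λ y → inj# (y ∷ b)) +_) (hits b) ⟨
           ∑Fin n (λ y → inj# (y ∷ b)) + ∑Fin n (λ y → inj# b * 𝟙 (hit? b y))
             ≡⟨ trans (+-comm (∑Fin n (λ y → inj# (y ∷ b))) _)
                  (sym (∑-+ (allFin n) (λ y → inj# b * 𝟙 (hit? b y)) (λ y → inj# (y ∷ b)))) ⟩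
           ∑Fin n (λ y → inj# b * 𝟙 (hit? b y) + inj# (y ∷ b))
             ≡⟨ trans (∑-cong (allFin n) (inj#-∷ b)) (∑Fin-const n (inj# b)) ⟩
           n * inj# b ∎) ⟩
    ∑ (fun N n) (λ b → n * inj# b)
      ≡⟨ ∑-*ˡ (fun N n) n inj# ⟩
    n * injections N n ∎
    where
    open ≡-Reasoning
    hits : ∀ b → ∑Fin n (λ y → inj# b * 𝟙 (hit? b y)) ≡ N * inj# b
    hits b with injective? (lookup b)
    ... | yes inj = trans (∑-*ˡ (allFin n) 1 _) (trans (cong (1 *_) (∑-hit b inj)) (*-comm 1 N))
    ... | no _    = trans (∑-zero (allFin n)) (sym (*-zeroʳ N))

  composeᵛ : Vec (Vec (Fin n) n) k → Fin n → Fin n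
  composeᵛ []       = id
  composeᵛ (h ∷ hs) = composeᵛ hs ∘ lookup h

  maps : ∀ k n → List (Vec (Vec (Fin n) n) k)
  maps k n = vecs (fun n n) k

  injective-∘ : ∀ (f : Fin n → Fin m) (b : Vec (Fin n) N) →
                Injective _≡_ _≡_ (lookup (Vec.map f b)) → Injective _≡_ _≡_ (lookup b)
  injective-∘ f b inj {i} {j} e = inj (trans (lookup-map i f b) (trans (cong f e) (sym (lookup-map j f b))))

  -- The values of a uniform map at `N` distinct points form a uniform `N`-tuple: every prescription
  -- extends in n^(n-N) ways.
  ∑-restrict : ∀ (b : Vec (Fin n) N) (φ : Vec (Fin n) N → ℕ) → Injective _≡_ _≡_ (lookup b) →
               ∑ (fun n n) (λ h → φ (Vec.map (lookup h) b)) * n ^ N ≡ n ^ n * ∑ (fun N n) φ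
  ∑-restrict {n} {N} b φ inj = begin
    ∑ (fun n n) (λ h → φ (Vec.map (lookup h) b)) * n ^ N
      ≡⟨ cong (_* n ^ N) (∑-cong (fun n n) (λ h → sym (∑-fun-δ (Vec.map (lookup h) b) φ))) ⟩
    ∑ (fun n n) (λ h → ∑ (fun N n) (λ c → 𝟙 (Vec.map (lookup h) b ≟ᵛ c) * φ c)) * n ^ N
      ≡⟨ cong (_* n ^ N) (trans (∑-swap (fun n n) (fun N n) _) (∑-cong (fun N n) (λ c → ∑-*ʳ (fun n n) _ (φ c)))) ⟩
    ∑ (fun N n) (λ c → ∑ (fun n n) (λ h → 𝟙 (Vec.map (lookup h) b ≟ᵛ c)) * φ c) * n ^ N
      ≡⟨ ∑-*ʳ (fun N n) _ (n ^ N) ⟨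
    ∑ (fun N n) (λ c → ∑ (fun n n) (λ h → 𝟙 (Vec.map (lookup h) b ≟ᵛ c)) * φ c * n ^ N)
      ≡⟨ ∑-cong (fun N n) (λ c → trans (solve 3 (λ e p q → e :* p :* q := e :* q :* p) refl
             (∑ (fun n n) (λ h → 𝟙 (Vec.map (lookup h) b ≟ᵛ c))) (φ c) (n ^ N))
           (cong (_* φ c) (extensions c))) ⟩
    ∑ (fun N n) (λ c → n ^ n * φ c)
      ≡⟨ ∑-*ˡ (fun N n) (n ^ n) φ ⟩
    n ^ n * ∑ (fun N n) φ ∎
    where
    open ≡-Reasoning
    open +-*-Solver
    extensions : ∀ c → ∑ (fun n n) (λ h → 𝟙 (Vec.map (lookup h) b ≟ᵛ c)) * n ^ N ≡ n ^ n
    extensions c = begin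
      ∑ (fun n n) (λ h → 𝟙 (Vec.map (lookup h) b ≟ᵛ c)) * n ^ N
        ≡⟨ cong (_* n ^ N) (trans (∑-cong (fun n n) (λ h → trans
             (𝟙-cong (Vec.map (lookup h) b ≟ᵛ c) (prescribed? h)
                (λ e i → trans (sym (lookup-map i (lookup h) b)) (cong (λ v → lookup v i) e))
                (λ e → trans (sym (tabulate∘lookup _))
                  (trans (tabulate-cong (λ i → trans (lookup-map i (lookup h) b) (e i))) (tabulate∘lookup c))))
             (sym (weight-pin b (lookup c) h (prescribed? h))))) (∑-weight (pin b (lookup c)))) ⟩
      ∏ (λ x → ∑Fin n (pin b (lookup c) x)) * n ^ N
        ≡⟨ ∏-injective (lookup b) inj _ n (λ x off → trans (∑-cong (allFin n) (λ y → pin-free b (lookup c) y off))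
             (trans (∑Fin-const n 1) (*-identityʳ n))) ⟩
      ∏ (λ i → ∑Fin n (pin b (lookup c) (lookup b i))) * n ^ n
        ≡⟨ cong (_* n ^ n) (∏-1 (λ i → trans (∑-cong (allFin n) (λ y → sym (*-identityˡ _)))
             (∑-pin b (lookup c) inj i (λ _ → 1)))) ⟩
      1 * n ^ n
        ≡⟨ *-identityˡ _ ⟩
      n ^ n ∎
      where
      prescribed? : ∀ h → Dec (∀ i → lookup h (lookup b i) ≡ lookup c i)
      prescribed? h = all? λ i → lookup h (lookup b i) ≟ lookup c i

  separated : (N k n : ℕ) → ℕ
  separated N k n = ∑ (maps k n) (λ hs → ∑ (fun N n) (λ b → inj# (Vec.map (composeᵛ hs) b)))

  -- Points that stay distinct under the composite are distinct to begin with. By `∑-restrict` their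
  -- images under the first map are then uniform, and the same count starts anew for the remaining
  -- maps.
  separated-suc : ∀ N k n → separated N (suc k) n * n ^ N ≡ n ^ n * (injections N n * separated N k n)
  separated-suc N k n = begin
    separated N (suc k) n * n ^ N
      ≡⟨ cong (_* n ^ N) (∑-vecs-suc (fun n n) k _) ⟩
    ∑ (fun n n) (λ h → ∑ (maps k n) (λ hs → ∑ (fun N n) (λ b → inj# (Vec.map (composeᵛ hs ∘ lookup h) b)))) * n ^ N
      ≡⟨ cong (_* n ^ N) (trans (∑-swap (fun n n) (maps k n) _) (∑-cong (maps k n) (λ hs → trans
           (∑-swap (fun n n) (fun N n) _)
           (∑-cong (fun N n) (λ b → ∑-cong (fun n n) (λ h → cong inj# (map-∘ (composeᵛ hs) (lookup h) b))))))) ⟩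
    ∑ (maps k n) (λ hs → ∑ (fun N n) (λ b → ∑ (fun n n) (λ h → φ hs (Vec.map (lookup h) b)))) * n ^ N
      ≡⟨ trans (sym (∑-*ʳ (maps k n) _ (n ^ N))) (∑-cong (maps k n) (λ hs → sym (∑-*ʳ (fun N n) _ (n ^ N)))) ⟩
    ∑ (maps k n) (λ hs → ∑ (fun N n) (λ b → ∑ (fun n n) (λ h → φ hs (Vec.map (lookup h) b)) * n ^ N))
      ≡⟨ ∑-cong (maps k n) (λ hs → trans (∑-cong (fun N n) (one-step hs)) (trans (∑-*ʳ (fun N n) inj# _)
           (solve 3 (λ i p s → i :* (p :* s) := p :* (i :* s)) refl (injections N n) (n ^ n) _))) ⟩
    ∑ (maps k n) (λ hs → n ^ n * (injections N n * ∑ (fun N n) (φ hs)))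
      ≡⟨ trans (∑-*ˡ (maps k n) (n ^ n) _) (cong (n ^ n *_) (∑-*ˡ (maps k n) (injections N n) _)) ⟩
    n ^ n * (injections N n * separated N k n) ∎
    where
    open ≡-Reasoning
    open +-*-Solver
    φ : Vec (Vec (Fin n) n) k → Vec (Fin n) N → ℕ
    φ hs c = inj# (Vec.map (composeᵛ hs) c)
    one-step : ∀ hs b → ∑ (fun n n) (λ h → φ hs (Vec.map (lookup h) b)) * n ^ N
                      ≡ inj# b * (n ^ n * ∑ (fun N n) (φ hs))
    one-step hs b with injective? (lookup b)
    ... | yes inj = trans (∑-restrict b (φ hs) inj) (sym (*-identityˡ _))
    ... | no ¬inj = cong (_* n ^ N) (trans (∑-cong (fun n n) (λ h →
      𝟙-no (injective? _) (λ inj → ¬inj (injective-∘ (lookup h) b (injective-∘ (composeᵛ hs) (Vec.map (lookup h) b) inj)))))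
      (∑-zero (fun n n)))

  -- The exponent is `suc k` for `k` maps because the points themselves must be distinct before any
  -- map acts.
  separated-closed : ∀ N k n → separated N k n * (n ^ N) ^ k ≡ (n ^ n) ^ k * injections N n ^ suc k
  separated-closed N zero n = trans
    (cong (λ s → (s + 0) * 1) (∑-cong (fun N n) (λ b → cong inj# (map-id b))))
    (solve 1 (λ s → (s :+ con 0) :* con 1 := con 1 :* (s :* con 1)) refl (injections N n))
    where open +-*-Solver
  separated-closed N (suc k) n = begin
    separated N (suc k) n * (n ^ N * (n ^ N) ^ k)
      ≡⟨ *-assoc (separated N (suc k) n) _ _ ⟨
    separated N (suc k) n * n ^ N * (n ^ N) ^ k
      ≡⟨ cong (_* (n ^ N) ^ k) (separated-suc N k n) ⟩
    n ^ n * (I * separated N k n) * (n ^ N) ^ k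
      ≡⟨ solve 4 (λ a i s b → a :* (i :* s) :* b := a :* i :* (s :* b)) refl (n ^ n) I (separated N k n) ((n ^ N) ^ k) ⟩
    n ^ n * I * (separated N k n * (n ^ N) ^ k)
      ≡⟨ cong (n ^ n * I *_) (separated-closed N k n) ⟩
    n ^ n * I * ((n ^ n) ^ k * I ^ suc k)
      ≡⟨ solve 4 (λ a i b j → a :* i :* (b :* j) := a :* b :* (i :* j)) refl (n ^ n) I ((n ^ n) ^ k) (I ^ suc k) ⟩
    (n ^ n) ^ suc k * I ^ suc (suc k) ∎
    where
    open ≡-Reasoning
    open +-*-Solver
    I = injections N n

  CyclicMap-cong : ∀ .{{_ : NonZero N}} {F G : Fin n → Fin n} → F ≗ G → CyclicMap N F → CyclicMap N G
  CyclicMap-cong {F = F} {G} F≗G (S , (M , image) , card , a , inj , onto , steps) =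
    S , (M , λ m M≤m y → mk⇔
      (λ y∈S → let x , e = Equivalence.to (image m M≤m y) y∈S in x , trans (sym (iterate-cong m x)) e)
      (λ (x , e) → Equivalence.from (image m M≤m y) (x , trans (iterate-cong m x) e))) ,
    card , a , inj , onto , λ i → trans (sym (F≗G (a i))) (steps i)
    where
    iterate-cong : ∀ m → (F ^∘ m) ≗ (G ^∘ m)
    iterate-cong zero    x = refl
    iterate-cong (suc m) x = trans (F≗G _) (cong G (iterate-cong m x))

  -- The first map is summed out, weighted by the fibre sizes of the composite
  -- of the others; fibre sizes then turn into N + 1 points followed along the
  -- other maps, the first N staying distinct and the last one joining them.
  cyclicSum : (N k n : ℕ) → ℕ
  cyclicSum N k n = ∑ (maps (suc k) n) (λ fs → ∑ (fun (suc N) n) (λ a →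
    𝟙 (attractingCycle? a (Vec.map (composeᵛ (Vec.tail fs)) (Vec.head fs)))))

  absorbed : (N k n : ℕ) → ℕ
  absorbed N k n = ∑ (maps k n) (λ hs → ∑ (fun N n) (λ b → ∑Fin n (λ y →
    inj# (Vec.map (composeᵛ hs) b) * 𝟙 (hit? (Vec.map (composeᵛ hs) b) (composeᵛ hs y)))))

  cyclicSum≡absorbed : ∀ N k n → cyclicSum N k n * (n * n ^ suc N) ≡ absorbed (suc N) k n * n ^ n
  cyclicSum≡absorbed N k n = begin
    cyclicSum N k n * c
      ≡⟨ cong (_* c) (trans (∑-vecs-suc (fun n n) k _) (trans (∑-swap (fun n n) (maps k n) _)
           (∑-cong (maps k n) (λ hs → ∑-swap (fun n n) (fun (suc N) n) _)))) ⟩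
    ∑ (maps k n) (λ hs → ∑ (fun (suc N) n) (λ a → ∑ (fun n n) (λ f → 𝟙 (attractingCycle? a (Vec.map (composeᵛ hs) f))))) * c
      ≡⟨ trans (sym (∑-*ʳ (maps k n) _ c)) (trans (∑-cong (maps k n) per-composite) (∑-*ʳ (maps k n) _ (n ^ n))) ⟩
    absorbed (suc N) k n * n ^ n ∎
    where
    open ≡-Reasoning
    c = n * n ^ suc N

    per-composite : ∀ hs →
      ∑ (fun (suc N) n) (λ a → ∑ (fun n n) (λ f → 𝟙 (attractingCycle? a (Vec.map (composeᵛ hs) f)))) * c
      ≡ ∑ (fun (suc N) n) (λ b → ∑Fin n (λ y →
          inj# (Vec.map (composeᵛ hs) b) * 𝟙 (hit? (Vec.map (composeᵛ hs) b) (composeᵛ hs y)))) * n ^ n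
    per-composite hs = begin
      ∑ (fun (suc N) n) (λ a → ∑ (fun n n) (λ f → 𝟙 (attractingCycle? a (Vec.map H f)))) * c
        ≡⟨ ∑-*ʳ (fun (suc N) n) _ c ⟨
      ∑ (fun (suc N) n) (λ a → ∑ (fun n n) (λ f → 𝟙 (attractingCycle? a (Vec.map H f))) * c)
        ≡⟨ ∑-cong (fun (suc N) n) (λ a → trans (cong (_* c) (unweighted {n} (λ F → 𝟙 (attractingCycle? a F))))
             (subst (λ W → ∑ (fun n n) (λ F → weight (λ _ → w) F * 𝟙 (attractingCycle? a F)) * (W * W ^ suc N)
                           ≡ weight (λ _ → w) a * (inj# a * ∑Fin n (λ z → w z * 𝟙 (hit? a z))) * W ^ n)
                    W≡n (∑-attracted a w))) ⟩
      ∑ (fun (suc N) n) (λ a → weight (λ _ → w) a * (inj# a * ∑Fin n (λ z → w z * 𝟙 (hit? a z))) * n ^ n)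
        ≡⟨ ∑-*ʳ (fun (suc N) n) _ (n ^ n) ⟩
      ∑ (fun (suc N) n) (λ a → weight (λ _ → w) a * (inj# a * ∑Fin n (λ z → w z * 𝟙 (hit? a z)))) * n ^ n
        -- Pushforward read backwards: the fibre size at each `lookup a i` becomes a choice of a
        -- point `lookup b i` over it. The following step does the same for the extra point `z`.
        ≡⟨ cong (_* n ^ n) (unweighted {suc N} (λ a → inj# a * ∑Fin n (λ z → w z * 𝟙 (hit? a z)))) ⟨
      ∑ (fun (suc N) n) (λ b → inj# (Vec.map H b) * ∑Fin n (λ z → w z * 𝟙 (hit? (Vec.map H b) z))) * n ^ n
        ≡⟨ cong (_* n ^ n) (∑-cong (fun (suc N) n) (λ b → trans (cong (inj# (Vec.map H b) *_)
             (trans (∑-push H (λ _ → 1) (λ z → 𝟙 (hit? (Vec.map H b) z))) (∑-cong (allFin n) (λ y → *-identityˡ _))))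
             (sym (∑-*ˡ (allFin n) (inj# (Vec.map H b)) _)))) ⟩
      ∑ (fun (suc N) n) (λ b → ∑Fin n (λ y → inj# (Vec.map H b) * 𝟙 (hit? (Vec.map H b) (H y)))) * n ^ n ∎
      where
      H = composeᵛ hs
      w : Fin n → ℕ
      w = push H (λ _ → 1)
      W≡n : ∑Fin n w ≡ n
      W≡n = trans (∑-push-1 H (λ _ → 1)) (trans (∑Fin-const n 1) (*-identityʳ n))
      unweighted : ∀ {m} (φ : Vec (Fin n) m → ℕ) →
                   ∑ (fun m n) (λ F → φ (Vec.map H F)) ≡ ∑ (fun m n) (λ G → weight (λ _ → w) G * φ G)
      unweighted {m} φ = trans (∑-cong (fun m n) (λ F → trans (sym (*-identityˡ _))
        (cong (_* φ (Vec.map H F)) (sym (∏-1 {m} (λ _ → refl)))))) (∑-fun-push H (λ _ _ → 1) φ)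

  absorbed+separated : ∀ N k n → absorbed N k n + separated (suc N) k n ≡ n * separated N k n
  absorbed+separated N k n = begin
    absorbed N k n + separated (suc N) k n
      ≡⟨ cong (absorbed N k n +_) (∑-cong (maps k n) (λ hs →
           trans (∑-vecs-suc (allFin n) N _) (∑-swap (allFin n) (fun N n) _))) ⟩
    absorbed N k n + ∑ (maps k n) (λ hs → ∑ (fun N n) (λ b → ∑Fin n (λ y → inj# (composeᵛ hs y ∷ Vec.map (composeᵛ hs) b))))
      ≡⟨ trans (sym (∑-+ (maps k n) _ _)) (∑-cong (maps k n) (λ hs → trans (sym (∑-+ (fun N n) _ _)) (∑-cong (fun N n) (λ b →
           trans (sym (∑-+ (allFin n) _ _)) (trans (∑-cong (allFin n) (λ y → inj#-∷ (Vec.map (composeᵛ hs) b) (composeᵛ hs y)))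
             (∑Fin-const n _)))))) ⟩
    ∑ (maps k n) (λ hs → ∑ (fun N n) (λ b → n * inj# (Vec.map (composeᵛ hs) b)))
      ≡⟨ trans (∑-cong (maps k n) (λ hs → ∑-*ˡ (fun N n) n _)) (∑-*ˡ (maps k n) n _) ⟩
    n * separated N k n ∎
    where open ≡-Reasoning

  -- Decoding the listed tuples

  ∑Fin-+ : ∀ m n (f : Fin (m + n) → ℕ) → ∑Fin (m + n) f ≡ ∑Fin m (λ i → f (i ↑ˡ n)) + ∑Fin n (λ j → f (m ↑ʳ j))
  ∑Fin-+ zero    n f = refl
  ∑Fin-+ (suc m) n f = trans (∑Fin-suc f) (trans (cong (f zero +_) (∑Fin-+ m n (f ∘ suc)))
    (trans (sym (+-assoc (f zero) _ _)) (cong (_+ ∑Fin n (λ j → f (suc m ↑ʳ j))) (sym (∑Fin-suc (λ i → f (i ↑ˡ n)))))))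

  ∑Fin-* : ∀ m n (f : Fin (m * n) → ℕ) → ∑Fin (m * n) f ≡ ∑Fin m (λ i → ∑Fin n (λ j → f (combine i j)))
  ∑Fin-* zero    n f = refl
  ∑Fin-* (suc m) n f = trans (∑Fin-+ n (m * n) f)
    (trans (cong (∑Fin n (λ j → f (j ↑ˡ (m * n))) +_) (∑Fin-* m n (λ i → f (n ↑ʳ i))))
           (sym (∑Fin-suc (λ i → ∑Fin n (λ j → f (combine {suc m} {n} i j))))))

  ∑-finToFun : ∀ m n (φ : Vec (Fin n) m → ℕ) → ∑Fin (n ^ m) (λ c → φ (tabulate (finToFun {n} {m} c))) ≡ ∑ (fun m n) φ
  ∑-finToFun zero    n φ = refl
  ∑-finToFun (suc m) n φ = begin
    ∑Fin (n * n ^ m) (λ c → φ (quotient (n ^ m) c ∷ tabulate (finToFun (remainder {n} (n ^ m) c))))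
      ≡⟨ ∑Fin-* n (n ^ m) _ ⟩
    ∑Fin n (λ x → ∑Fin (n ^ m) (λ c → φ (quotient (n ^ m) (combine x c) ∷ tabulate (finToFun (remainder {n} (n ^ m) (combine x c))))))
      ≡⟨ ∑-cong (allFin n) (λ x → ∑-cong (allFin (n ^ m)) (λ c →
           cong (λ (q , r) → φ (q ∷ tabulate (finToFun r))) (remQuot-combine x c))) ⟩
    ∑Fin n (λ x → ∑Fin (n ^ m) (λ c → φ (x ∷ tabulate (finToFun c))))
      ≡⟨ ∑-cong (allFin n) (λ x → ∑-finToFun m n (φ ∘ (x ∷_))) ⟩
    ∑Fin n (λ x → ∑ (fun m n) (λ F → φ (x ∷ F)))
      ≡⟨ ∑-vecs-suc (allFin n) m φ ⟨
    ∑ (fun (suc m) n) φ ∎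
    where open ≡-Reasoning

  -- The listed tuples are coded twice, each map by a number below n^n and the sequence of these
  -- numbers by another number. This lifts the decoding of single maps to sequences.
  ∑-vecs-map : ∀ (h : A → B) (xs : List A) (ys : List B) → (∀ φ → ∑ xs (φ ∘ h) ≡ ∑ ys φ) →
               ∀ m (φ : Vec B m → ℕ) → ∑ (vecs xs m) (φ ∘ Vec.map h) ≡ ∑ (vecs ys m) φ
  ∑-vecs-map h xs ys e zero    φ = refl
  ∑-vecs-map h xs ys e (suc m) φ = trans (∑-vecs-suc xs m _)
    (trans (∑-cong xs (λ x → ∑-vecs-map h xs ys e m (φ ∘ (h x ∷_))))
    (trans (e (λ y → ∑ (vecs ys m) (φ ∘ (y ∷_)))) (sym (∑-vecs-suc ys m φ))))

  composeᵛ≗compose : ∀ (fs : Vec (Vec (Fin n) n) k) (f : Tuple k n) → (∀ i → lookup (lookup fs i) ≗ f i) →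
                     composeᵛ fs ≗ compose f
  composeᵛ≗compose []       f e x = refl
  composeᵛ≗compose (h ∷ fs) f e x = trans (cong (composeᵛ fs) (e zero x)) (composeᵛ≗compose fs (f ∘ suc) (e ∘ suc) (f zero x))

  count : (k N n : ℕ) .{{_ : NonZero N}} → ℕ
  count k N n = length (filter (eventuallyCyclic? N) (tuples k n))

  count≡cyclicSum : ∀ N k n → suc N * count (suc k) (suc N) n ≡ cyclicSum N k n
  count≡cyclicSum N k n = begin
    suc N * count (suc k) (suc N) n
      ≡⟨ cong (suc N *_) (trans (length-filter-∑ (eventuallyCyclic? (suc N)) (tuples (suc k) n))
           (∑-map _ (allFin ((n ^ n) ^ suc k)) _)) ⟩
    suc N * ∑Fin ((n ^ n) ^ suc k) (λ c → 𝟙 (eventuallyCyclic? (suc N) (tuple c)))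
      ≡⟨ ∑-*ˡ (allFin ((n ^ n) ^ suc k)) (suc N) _ ⟨
    ∑Fin ((n ^ n) ^ suc k) (λ c → suc N * 𝟙 (eventuallyCyclic? (suc N) (tuple c)))
      ≡⟨ ∑-cong (allFin ((n ^ n) ^ suc k)) (λ c → enumerate c (tabulate (finToFun c)) (lookup∘tabulate (finToFun c))) ⟩
    ∑Fin ((n ^ n) ^ suc k) (λ c → φ (Vec.map decode (tabulate (finToFun {n ^ n} {suc k} c))))
      ≡⟨ ∑-finToFun (suc k) (n ^ n) (φ ∘ Vec.map decode) ⟩
    ∑ (fun (suc k) (n ^ n)) (φ ∘ Vec.map decode)
      ≡⟨ ∑-vecs-map decode (allFin (n ^ n)) (fun n n) (∑-finToFun n n) (suc k) φ ⟩
    cyclicSum N k n ∎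
    where
    open ≡-Reasoning
    tuple : Fin ((n ^ n) ^ suc k) → Tuple (suc k) n
    tuple c i = finToFun {n} {n} (finToFun {n ^ n} {suc k} c i)
    decode : Fin (n ^ n) → Vec (Fin n) n
    decode c = tabulate (finToFun {n} {n} c)
    composite : Vec (Vec (Fin n) n) (suc k) → Vec (Fin n) n
    composite fs = Vec.map (composeᵛ (Vec.tail fs)) (Vec.head fs)
    φ : Vec (Vec (Fin n) n) (suc k) → ℕ
    φ fs = ∑ (fun (suc N) n) (λ a → 𝟙 (attractingCycle? a (composite fs)))
    enumerate : ∀ c (ds : Vec (Fin (n ^ n)) (suc k)) → (∀ i → lookup ds i ≡ finToFun {n ^ n} {suc k} c i) →
                suc N * 𝟙 (eventuallyCyclic? (suc N) (tuple c)) ≡ φ (Vec.map decode ds)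
    enumerate c (d ∷ ds) e = trans
      (cong (suc N *_) (𝟙-cong (eventuallyCyclic? (suc N) (tuple c)) cyclic?
        (CyclicMap-cong (sym ∘ agree)) (CyclicMap-cong agree)))
      (sym (∑-attractingCycle F cyclic?))
      where
      fs = Vec.map decode (d ∷ ds)
      F = composite fs
      agree : lookup F ≗ compose (tuple c)
      agree x = trans (lookup-map x (composeᵛ (Vec.tail fs)) (decode d))
        (composeᵛ≗compose fs (tuple c) (λ i x → trans (cong (λ v → lookup v x) (lookup-map i decode (d ∷ ds)))
          (trans (lookup∘tabulate _ x) (cong (λ t → finToFun t x) (e i)))) x)
      cyclic? : Dec (CyclicMap (suc N) (lookup F))
      cyclic? = map′ (CyclicMap-cong (sym ∘ agree)) (CyclicMap-cong agree)
        (eventuallyCyclic? (suc N) (tuple c))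

  -- The closed form of the count

  *-^-distrib : ∀ a b k → (a * b) ^ k ≡ a ^ k * b ^ k
  *-^-distrib a b zero    = refl
  *-^-distrib a b (suc k) = trans (cong (a * b *_) (*-^-distrib a b k))
    (solve 4 (λ a b c d → a :* b :* (c :* d) := a :* c :* (b :* d)) refl a b (a ^ k) (b ^ k))
    where open +-*-Solver

  -- Dividing by `(n ^ n) ^ suc k * (n ^ suc (suc N)) ^ suc k` expresses N+1 times the probability
  -- as a difference of two `suc k`-th powers: those of the probabilities that N+1 and that N+2
  -- uniformly random points are distinct.
  count-formula : ∀ k N n → let I = injections (suc N) n ; I′ = injections (suc (suc N)) n in
    suc N * count (suc k) (suc N) n * (n ^ suc (suc N)) ^ suc k + (n ^ n) ^ suc k * I′ ^ suc k
    ≡ (n ^ n) ^ suc k * (n ^ suc k * I ^ suc k)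
  count-formula k N n = begin
    suc N * count (suc k) (suc N) n * (X * X ^ k) + E * E ^ k * I′ ^ suc k
      ≡⟨ cong₂ _+_ (trans (cong (_* (X * X ^ k)) (count≡cyclicSum N k n)) (sym (*-assoc (cyclicSum N k n) X (X ^ k))))
           (trans (*-assoc E _ _) (cong (E *_) (sym (separated-closed (suc (suc N)) k n)))) ⟩
    cyclicSum N k n * X * X ^ k + E * (separated (suc (suc N)) k n * X ^ k)
      ≡⟨ cong (λ t → t * X ^ k + E * (separated (suc (suc N)) k n * X ^ k)) (cyclicSum≡absorbed N k n) ⟩
    absorbed (suc N) k n * E * X ^ k + E * (separated (suc (suc N)) k n * X ^ k)
      ≡⟨ solve 4 (λ q a x s → q :* a :* x :+ a :* (s :* x) := (q :+ s) :* (a :* x)) refl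
           (absorbed (suc N) k n) E (X ^ k) (separated (suc (suc N)) k n) ⟩
    (absorbed (suc N) k n + separated (suc (suc N)) k n) * (E * X ^ k)
      ≡⟨ cong₂ (λ s t → s * (E * t)) (absorbed+separated (suc N) k n) (*-^-distrib n (n ^ suc N) k) ⟩
    n * separated (suc N) k n * (E * (n ^ k * (n ^ suc N) ^ k))
      ≡⟨ solve 5 (λ n s a m x → n :* s :* (a :* (m :* x)) := a :* (n :* m) :* (s :* x)) refl
           n (separated (suc N) k n) E (n ^ k) ((n ^ suc N) ^ k) ⟩
    E * n ^ suc k * (separated (suc N) k n * (n ^ suc N) ^ k)
      ≡⟨ cong (E * n ^ suc k *_) (separated-closed (suc N) k n) ⟩
    E * n ^ suc k * (E ^ k * I ^ suc k)
      ≡⟨ solve 4 (λ a m b i → a :* m :* (b :* i) := a :* b :* (m :* i)) refl E (n ^ suc k) (E ^ k) (I ^ suc k) ⟩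
    E * E ^ k * (n ^ suc k * I ^ suc k) ∎
    where
    open ≡-Reasoning
    open +-*-Solver
    X = n ^ suc (suc N)
    E = n ^ n
    I = injections (suc N) n
    I′ = injections (suc (suc N)) n

  injections-! : ∀ N d n → N + d ≡ n → injections N n * d ! ≡ n !
  injections-! zero    d .d refl = *-identityˡ (d !)
  injections-! (suc N) d n e = begin
    injections (suc N) n * d !        ≡⟨ cong (_* d !) step′ ⟩
    suc d * injections N n * d !      ≡⟨ solve 3 (λ s i f → s :* i :* f := i :* (s :* f)) refl (suc d) (injections N n) (d !) ⟩
    injections N n * suc d !          ≡⟨ injections-! N (suc d) n N+1+d≡n ⟩
    n ! ∎
    where
    open ≡-Reasoning
    open +-*-Solver
    N+1+d≡n = trans (+-suc N d) e
    step′ : injections (suc N) n ≡ suc d * injections N n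
    step′ = +-cancelʳ-≡ (N * injections N n) _ _ (trans (injections-suc N n)
      (trans (cong (_* injections N n) (trans (sym N+1+d≡n) (+-comm N (suc d)))) (*-distribʳ-+ (injections N n) (suc d) N)))

open Counting using (count; injections; injections-suc; injections-!; count-formula)
open import Algebra.Bundles using (module CommutativeRing)
open import Data.Integer.Base using (+_)
open import Data.Nat.Base as ℕ using (ℕ; NonZero; _∸_; _!)
open import Data.Nat.Properties using (m^n≢0; _!≢0)
open import Data.Product.Base using (∃; _×_)
open import Data.Rational.Base using (ℚ; _/_; 1ℚ; _*_; _-_; _≤_; ∣_∣)
open import Data.Rational.Properties using (+-*-commutativeRing)
open import Algebra.Properties.Semiring.Exp (CommutativeRing.semiring +-*-commutativeRing) using (_^_)
open import Relation.Binary.PropositionalEquality using (_≡_)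
open import Algebra.Properties.CommutativeSemiring.Exp (CommutativeRing.commutativeSemiring +-*-commutativeRing) using (^-distrib-*; ^-assocʳ)
import Data.Integer.Base as ℤ
import Data.Integer.Properties as ℤ
open import Data.Nat.Base using (zero; suc)
import Data.Nat.Properties as ℕ
open import Data.Product.Base using (_,_; proj₁; proj₂)
open import Data.Rational.Base using (0ℚ; _+_; -_; fromℚᵘ; nonNegative)
open import Data.Rational.Properties
  using (toℚᵘ-injective; toℚᵘ-cancel-≤; toℚᵘ-fromℚᵘ; toℚᵘ-homo-+; toℚᵘ-homo-*; fromℚᵘ-cong;
    *-assoc; *-comm; *-identityˡ; *-identityʳ; ≤-refl; ≤-trans; ≤-reflexive; +-mono-≤;
    0≤∣p∣; 0≤p⇒∣p∣≡p; ∣p+q∣≤∣p∣+∣q∣; ∣p*q∣≡∣p∣*∣q∣; *-monoˡ-≤-nonNeg; *-monoʳ-≤-nonNeg; module ≤-Reasoning)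
open import Data.Rational.Solver using (module +-*-Solver)
open import Data.Rational.Unnormalised.Base as ℚᵘ using (mkℚᵘ; *≡*; *≤*)
import Data.Rational.Unnormalised.Properties as ℚᵘ
open import Function.Base using (_∘_)
open import Relation.Binary.PropositionalEquality using (refl; sym; trans; cong; cong₂; module ≡-Reasoning)

-- Rational arithmetic and asymptotics

fromℚᵘ-+ : ∀ p q → fromℚᵘ (p ℚᵘ.+ q) ≡ fromℚᵘ p + fromℚᵘ q
fromℚᵘ-+ p q = toℚᵘ-injective (ℚᵘ.≃-trans (toℚᵘ-fromℚᵘ (p ℚᵘ.+ q)) (ℚᵘ.≃-sym
  (ℚᵘ.≃-trans (toℚᵘ-homo-+ (fromℚᵘ p) (fromℚᵘ q)) (ℚᵘ.+-cong (toℚᵘ-fromℚᵘ p) (toℚᵘ-fromℚᵘ q)))))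

fromℚᵘ-* : ∀ p q → fromℚᵘ (p ℚᵘ.* q) ≡ fromℚᵘ p * fromℚᵘ q
fromℚᵘ-* p q = toℚᵘ-injective (ℚᵘ.≃-trans (toℚᵘ-fromℚᵘ (p ℚᵘ.* q)) (ℚᵘ.≃-sym
  (ℚᵘ.≃-trans (toℚᵘ-homo-* (fromℚᵘ p) (fromℚᵘ q)) (ℚᵘ.*-cong (toℚᵘ-fromℚᵘ p) (toℚᵘ-fromℚᵘ q)))))

fromℚᵘ-mono-≤ : ∀ {p q} → p ℚᵘ.≤ q → fromℚᵘ p ≤ fromℚᵘ q
fromℚᵘ-mono-≤ {p} {q} h = toℚᵘ-cancel-≤ (ℚᵘ.≤-respʳ-≃ (ℚᵘ.≃-sym (toℚᵘ-fromℚᵘ q))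
  (ℚᵘ.≤-respˡ-≃ (ℚᵘ.≃-sym (toℚᵘ-fromℚᵘ p)) h))

-- Abstract, so that type checking never unfolds the normalisation of fractions.
abstract

  ι : ℕ → ℚ
  ι m = + m / 1

  inv : (m : ℕ) .{{_ : NonZero m}} → ℚ
  inv m = + 1 / m

  ι-+ : ∀ a b → ι (a ℕ.+ b) ≡ ι a + ι b
  ι-+ a b = trans (fromℚᵘ-cong {mkℚᵘ (+ (a ℕ.+ b)) 0} {mkℚᵘ (+ a) 0 ℚᵘ.+ mkℚᵘ (+ b) 0}
    (*≡* (cong (ℤ._* + 1) (sym (cong₂ ℤ._+_ (ℤ.*-identityʳ (+ a)) (ℤ.*-identityʳ (+ b)))))))
    (fromℚᵘ-+ (mkℚᵘ (+ a) 0) (mkℚᵘ (+ b) 0))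

  ι-* : ∀ a b → ι (a ℕ.* b) ≡ ι a * ι b
  ι-* a b = trans (cong (_/ 1) (ℤ.pos-* a b)) (fromℚᵘ-* (mkℚᵘ (+ a) 0) (mkℚᵘ (+ b) 0))

  ι-1 : ι 1 ≡ 1ℚ
  ι-1 = refl

  ι-0 : ι 0 ≡ 0ℚ
  ι-0 = refl

  1/≡inv : ∀ b .{{_ : NonZero b}} → + 1 / b ≡ inv b
  1/≡inv b = refl

  /≡ι*inv : ∀ a b .{{_ : NonZero b}} → + a / b ≡ ι a * inv b
  /≡ι*inv a (suc b) = trans (fromℚᵘ-cong {mkℚᵘ (+ a) b} {mkℚᵘ (+ a) 0 ℚᵘ.* mkℚᵘ (+ 1) b}
    (*≡* (cong₂ ℤ._*_ (sym (ℤ.*-identityʳ (+ a))) (cong (+_ ∘ suc) (ℕ.+-identityʳ b)))))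
    (fromℚᵘ-* (mkℚᵘ (+ a) 0) (mkℚᵘ (+ 1) b))

  ι*inv : ∀ b .{{_ : NonZero b}} → ι b * inv b ≡ 1ℚ
  ι*inv (suc b) = trans (sym (/≡ι*inv (suc b) (suc b)))
    (fromℚᵘ-cong {mkℚᵘ (+ suc b) b} {mkℚᵘ (+ 1) 0} (*≡* (ℤ.*-comm (+ suc b) (+ 1))))

  0≤inv : ∀ n .{{_ : NonZero n}} → 0ℚ ≤ inv n
  0≤inv (suc n) = fromℚᵘ-mono-≤ {mkℚᵘ (+ 0) 0} {mkℚᵘ (+ 1) n} (*≤* (ℤ.+≤+ ℕ.z≤n))

  inv≤1 : ∀ n .{{_ : NonZero n}} → inv n ≤ 1ℚ
  inv≤1 (suc n) = fromℚᵘ-mono-≤ {mkℚᵘ (+ 1) n} {mkℚᵘ (+ 1) 0} (*≤* (ℤ.+≤+ (ℕ.s≤s ℕ.z≤n)))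

ι-^ : ∀ a k → ι (a ℕ.^ k) ≡ ι a ^ k
ι-^ a zero    = ι-1
ι-^ a (suc k) = trans (ι-* a (a ℕ.^ k)) (cong (ι a *_) (ι-^ a k))

inverse-unique : ∀ {a x y} → a * x ≡ 1ℚ → a * y ≡ 1ℚ → x ≡ y
inverse-unique {a} {x} {y} ax ay = begin
  x            ≡⟨ *-identityʳ x ⟨
  x * 1ℚ       ≡⟨ cong (x *_) ay ⟨
  x * (a * y)  ≡⟨ solve 3 (λ x a y → x :* (a :* y) := a :* x :* y) refl x a y ⟩
  a * x * y    ≡⟨ cong (_* y) ax ⟩
  1ℚ * y       ≡⟨ *-identityˡ y ⟩
  y            ∎
  where
  open ≡-Reasoning
  open +-*-Solver

1^ : ∀ k → 1ℚ ^ k ≡ 1ℚ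
1^ zero    = refl
1^ (suc k) = trans (*-identityˡ (1ℚ ^ k)) (1^ k)

^*^≡1 : ∀ x y k → x * y ≡ 1ℚ → x ^ k * y ^ k ≡ 1ℚ
^*^≡1 x y k e = trans (sym (^-distrib-* x y k)) (trans (cong (_^ k) e) (1^ k))

inv-^ : ∀ n k .{{_ : NonZero n}} .{{_ : NonZero (n ℕ.^ k)}} → inv (n ℕ.^ k) ≡ inv n ^ k
inv-^ n k = inverse-unique {ι (n ℕ.^ k)} (ι*inv (n ℕ.^ k))
  (trans (cong (_* inv n ^ k) (ι-^ n k)) (^*^≡1 (ι n) (inv n) k (ι*inv n)))

-- The exact formula

ι-injections-suc : ∀ N n → ι (injections (suc N) n) ≡ (ι n - ι N) * ι (injections N n)
ι-injections-suc N n = begin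
  ι (injections (suc N) n)
    ≡⟨ solve 2 (λ a b → a := a :+ b :- b) refl (ι (injections (suc N) n)) (ι N * ι (injections N n)) ⟩
  ι (injections (suc N) n) + ι N * ι (injections N n) - ι N * ι (injections N n)
    ≡⟨ cong (_- ι N * ι (injections N n)) (trans (cong (λ t → ι (injections (suc N) n) + t) (sym (ι-* N (injections N n))))
         (trans (sym (ι-+ (injections (suc N) n) (N ℕ.* injections N n)))
         (trans (cong ι (injections-suc N n)) (ι-* n (injections N n))))) ⟩
  ι n * ι (injections N n) - ι N * ι (injections N n)
    ≡⟨ solve 3 (λ n m i → n :* i :- m :* i := (n :- m) :* i) refl (ι n) (ι N) (ι (injections N n)) ⟩
  (ι n - ι N) * ι (injections N n) ∎
  where
  open ≡-Reasoning
  open +-*-Solver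

module _ (k N n : ℕ) .{{nz : NonZero n}} where

  private
    K = suc k
    ε = inv n
    n̂ = ι n
    N̂ = ι (suc N)
    Î = ι (injections (suc N) n)

  N*p : N̂ * p K (suc N) n ≡ (ε ^ suc N * Î) ^ K * (1ℚ - (1ℚ - N̂ * ε) ^ K)
  N*p = begin
    N̂ * p K (suc N) n
      ≡⟨ cong (N̂ *_) (trans (/≡ι*inv C (n ℕ.^ (K ℕ.* n)) {{m^n≢0 n (K ℕ.* n)}})
           (cong (ι C *_) (trans (inv-^ n (K ℕ.* n) {{nz}} {{m^n≢0 n (K ℕ.* n)}})
             (trans (cong (ε ^_) (ℕ.*-comm K n)) (sym (^-assocʳ ε n K)))))) ⟩
    N̂ * (ι C * E)
      ≡⟨ *-assoc N̂ (ι C) E ⟨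
    N̂ * ι C * E
      ≡⟨ trans (sym (*-identityʳ _)) (cong (N̂ * ι C * E *_) (sym XY)) ⟩
    N̂ * ι C * E * (X * Y)
      -- The inserted factor `X * Y` and the added and subtracted `A * I′` produce the left side of
      -- `formula`.
      ≡⟨ solve 6 (λ m e x y a i → m :* e :* (x :* y) := (m :* x :+ a :* i) :* (e :* y) :- (a :* e) :* (i :* y))
           refl (N̂ * ι C) E X Y A I′ ⟩
    (N̂ * ι C * X + A * I′) * (E * Y) - (A * E) * (I′ * Y)
      ≡⟨ cong (λ t → t * (E * Y) - (A * E) * (I′ * Y)) formula ⟩
    A * (n̂ ^ K * Î ^ K) * (E * Y) - (A * E) * (I′ * Y)
      ≡⟨ solve 6 (λ a m i e y j → a :* (m :* i) :* (e :* y) :- a :* e :* (j :* y) := a :* e :* (m :* i :* y :- j :* y))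
           refl A (n̂ ^ K) (Î ^ K) E Y I′ ⟩
    A * E * (n̂ ^ K * Î ^ K * Y - I′ * Y)
      ≡⟨ cong₂ (λ s t → s * t) AE (cong₂ _-_ full missed) ⟩
    1ℚ * (J ^ K - J ^ K * (1ℚ - N̂ * ε) ^ K)
      ≡⟨ solve 2 (λ j q → con 1ℚ :* (j :- j :* q) := j :* (con 1ℚ :- q)) refl (J ^ K) ((1ℚ - N̂ * ε) ^ K) ⟩
    J ^ K * (1ℚ - (1ℚ - N̂ * ε) ^ K) ∎
    where
    open ≡-Reasoning
    open +-*-Solver
    C = count K (suc N) n
    J = ε ^ suc N * Î
    E = (ε ^ n) ^ K
    A = (n̂ ^ n) ^ K
    X = (n̂ ^ suc (suc N)) ^ K
    Y = (ε ^ suc (suc N)) ^ K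
    I′ = ((n̂ - N̂) * Î) ^ K

    XY : X * Y ≡ 1ℚ
    XY = ^*^≡1 (n̂ ^ suc (suc N)) (ε ^ suc (suc N)) K (^*^≡1 n̂ ε (suc (suc N)) (ι*inv n))
    AE : A * E ≡ 1ℚ
    AE = ^*^≡1 (n̂ ^ n) (ε ^ n) K (^*^≡1 n̂ ε n (ι*inv n))

    formula : N̂ * ι C * X + A * I′ ≡ A * (n̂ ^ K * Î ^ K)
    formula = begin
      N̂ * ι C * X + A * I′
        ≡⟨ cong₂ _+_
             (trans (ι-* (suc N ℕ.* C) ((n ℕ.^ suc (suc N)) ℕ.^ K)) (cong₂ _*_ (ι-* (suc N) C) (ι-^^ (suc (suc N)))))
             (trans (ι-* ((n ℕ.^ n) ℕ.^ K) _) (cong₂ _*_ (ι-^^ n)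
               (trans (ι-^ (injections (suc (suc N)) n) K) (cong (_^ K) (ι-injections-suc (suc N) n))))) ⟨
      ι (suc N ℕ.* C ℕ.* (n ℕ.^ suc (suc N)) ℕ.^ K) + ι ((n ℕ.^ n) ℕ.^ K ℕ.* injections (suc (suc N)) n ℕ.^ K)
        ≡⟨ trans (sym (ι-+ (suc N ℕ.* C ℕ.* (n ℕ.^ suc (suc N)) ℕ.^ K) _)) (cong ι (count-formula k N n)) ⟩
      ι ((n ℕ.^ n) ℕ.^ K ℕ.* (n ℕ.^ K ℕ.* injections (suc N) n ℕ.^ K))
        ≡⟨ trans (ι-* ((n ℕ.^ n) ℕ.^ K) _) (cong₂ _*_ (ι-^^ n)
             (trans (ι-* (n ℕ.^ K) _) (cong₂ _*_ (ι-^ n K) (ι-^ (injections (suc N) n) K)))) ⟩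
      A * (n̂ ^ K * Î ^ K) ∎
      where
      ι-^^ : ∀ m → ι ((n ℕ.^ m) ℕ.^ K) ≡ (n̂ ^ m) ^ K
      ι-^^ m = trans (ι-^ (n ℕ.^ m) K) (cong (_^ K) (ι-^ n m))

    full : n̂ ^ K * Î ^ K * Y ≡ J ^ K
    full = begin
      n̂ ^ K * Î ^ K * Y                   ≡⟨ cong (_* Y) (^-distrib-* n̂ Î K) ⟨
      (n̂ * Î) ^ K * Y                     ≡⟨ ^-distrib-* (n̂ * Î) (ε ^ suc (suc N)) K ⟨
      (n̂ * Î * (ε * ε ^ suc N)) ^ K
        ≡⟨ cong (_^ K) (trans (solve 4 (λ n i e f → n :* i :* (e :* f) := n :* e :* (f :* i)) refl n̂ Î ε (ε ^ suc N))
             (trans (cong (_* J) (ι*inv n)) (*-identityˡ J))) ⟩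
      J ^ K ∎

    missed : I′ * Y ≡ J ^ K * (1ℚ - N̂ * ε) ^ K
    missed = begin
      I′ * Y                                       ≡⟨ ^-distrib-* ((n̂ - N̂) * Î) (ε ^ suc (suc N)) K ⟨
      ((n̂ - N̂) * Î * (ε * ε ^ suc N)) ^ K
        ≡⟨ cong (_^ K) (trans (solve 5 (λ n m i e f → (n :- m) :* i :* (e :* f) := f :* i :* (n :* e :- m :* e))
               refl n̂ N̂ Î ε (ε ^ suc N))
             (cong (λ t → J * (t - N̂ * ε)) (ι*inv n))) ⟩
      (J * (1ℚ - N̂ * ε)) ^ K                       ≡⟨ ^-distrib-* J (1ℚ - N̂ * ε) K ⟩
      J ^ K * (1ℚ - N̂ * ε) ^ K ∎

  p-formula : p K (suc N) n ≡ inv (suc N) * ((ε ^ suc N * Î) ^ K * (1ℚ - (1ℚ - N̂ * ε) ^ K))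
  p-formula = begin
    p K (suc N) n                                 ≡⟨ *-identityˡ _ ⟨
    1ℚ * p K (suc N) n                            ≡⟨ cong (_* p K (suc N) n) (trans (*-comm (inv (suc N)) N̂) (ι*inv (suc N))) ⟨
    inv (suc N) * N̂ * p K (suc N) n               ≡⟨ *-assoc (inv (suc N)) N̂ _ ⟩
    inv (suc N) * (N̂ * p K (suc N) n)             ≡⟨ cong (inv (suc N) *_) N*p ⟩
    inv (suc N) * ((ε ^ suc N * Î) ^ K * (1ℚ - (1ℚ - N̂ * ε) ^ K)) ∎
    where open ≡-Reasoning

ι-injections : ∀ N n .{{_ : NonZero n}} → N ℕ.≤ n →
               (+ ((n ∸ 1) !) / ((n ∸ N) !)) {{(n ∸ N) !≢0}} ≡ inv n * ι (injections N n)
ι-injections N n@(suc m) N≤n = begin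
  (+ (m !) / (d !)) {{d !≢0}}          ≡⟨ /≡ι*inv (m !) (d !) {{d !≢0}} ⟩
  ι (m !) * δ                          ≡⟨ *-identityˡ _ ⟨
  1ℚ * (ι (m !) * δ)                   ≡⟨ cong (_* (ι (m !) * δ)) (ι*inv n) ⟨
  ι n * inv n * (ι (m !) * δ)          ≡⟨ solve 4 (λ n e f d → n :* e :* (f :* d) := e :* (n :* f :* d)) refl (ι n) (inv n) (ι (m !)) δ ⟩
  inv n * (ι n * ι (m !) * δ)          ≡⟨ cong (λ t → inv n * (t * δ)) (trans (sym (ι-* n (m !)))
                                            (trans (cong ι (sym (injections-! N d n (ℕ.m+[n∸m]≡n N≤n)))) (ι-* (injections N n) (d !)))) ⟩
  inv n * (ι (injections N n) * ι (d !) * δ) ≡⟨ cong (inv n *_) (trans (*-assoc (ι (injections N n)) _ δ)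
                                            (trans (cong (ι (injections N n) *_) (ι*inv (d !) {{d !≢0}})) (*-identityʳ _))) ⟩
  inv n * ι (injections N n) ∎
  where
  open ≡-Reasoning
  open +-*-Solver
  d = n ∸ N
  δ = inv (d !) {{d !≢0}}

exact : ∀ k N n .{{_ : NonZero n}} → suc N ℕ.≤ n → p (suc k) (suc N) n ≡
  (+ 1 / suc N)
  * (+ 1 / (n ℕ.^ (suc k ℕ.* N))) {{m^n≢0 n (suc k ℕ.* N)}}
  * ((+ ((n ∸ 1) !) / ((n ∸ suc N) !)) {{(n ∸ suc N) !≢0}}) ^ suc k
  * (1ℚ - (1ℚ - + suc N / n) ^ suc k)
exact k N n N<n = begin
  p K (suc N) n
    ≡⟨ p-formula k N n ⟩
  inv (suc N) * ((ε ^ suc N * Î) ^ K * Q)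
    -- One of the `suc N` factors `ε` joins the number of injections, because (n-1)! is n!/n; the
    -- other `N` give the power of n in front.
    ≡⟨ cong (λ t → inv (suc N) * (t * Q)) (trans
         (cong (_^ K) (solve 3 (λ e f i → e :* f :* i := f :* (e :* i)) refl ε (ε ^ N) Î)) (^-distrib-* (ε ^ N) (ε * Î) K)) ⟩
  inv (suc N) * ((ε ^ N) ^ K * (ε * Î) ^ K * Q)
    ≡⟨ solve 4 (λ a b c d → a :* (b :* c :* d) := a :* b :* c :* d) refl (inv (suc N)) ((ε ^ N) ^ K) ((ε * Î) ^ K) Q ⟩
  inv (suc N) * (ε ^ N) ^ K * (ε * Î) ^ K * Q
    ≡⟨ cong₂ _*_ (cong₂ (λ s t → s * t ^ K)
         (cong₂ _*_ (1/≡inv (suc N)) (trans (1/≡inv (n ℕ.^ (K ℕ.* N)) {{m^n≢0 n (K ℕ.* N)}})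
           (trans (inv-^ n (K ℕ.* N) {{_}} {{m^n≢0 n (K ℕ.* N)}}) (trans (cong (ε ^_) (ℕ.*-comm K N)) (sym (^-assocʳ ε N K))))))
         (ι-injections (suc N) n N<n))
         (cong (λ t → 1ℚ - (1ℚ - t) ^ K) (/≡ι*inv (suc N) n)) ⟨
  _ ∎
  where
  open ≡-Reasoning
  open +-*-Solver
  K = suc k
  ε = inv n
  Î = ι (injections (suc N) n)
  Q = 1ℚ - (1ℚ - ι (suc N) * ε) ^ K

-- Expansion at ε = 0 with bounded remainders

Bounded : (ℚ → ℚ) → Set
Bounded g = ∃ λ C → ∀ ε → 0ℚ ≤ ε → ε ≤ 1ℚ → ∣ g ε ∣ ≤ C

bounded-const : ∀ c → Bounded (λ _ → c)
bounded-const c = ∣ c ∣ , λ _ _ _ → ≤-refl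

bounded-id : Bounded (λ ε → ε)
bounded-id = 1ℚ , λ ε 0≤ε ε≤1 → ≤-trans (≤-reflexive (0≤p⇒∣p∣≡p 0≤ε)) ε≤1

bounded-+ : ∀ {f g} → Bounded f → Bounded g → Bounded (λ ε → f ε + g ε)
bounded-+ {f} {g} (C , hf) (D , hg) = C + D , λ ε 0≤ε ε≤1 →
  ≤-trans (∣p+q∣≤∣p∣+∣q∣ (f ε) (g ε)) (+-mono-≤ (hf ε 0≤ε ε≤1) (hg ε 0≤ε ε≤1))

bounded-* : ∀ {f g} → Bounded f → Bounded g → Bounded (λ ε → f ε * g ε)
bounded-* {f} {g} (C , hf) (D , hg) = C * D , λ ε 0≤ε ε≤1 → begin
  ∣ f ε * g ε ∣       ≡⟨ ∣p*q∣≡∣p∣*∣q∣ (f ε) (g ε) ⟩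
  ∣ f ε ∣ * ∣ g ε ∣   ≤⟨ *-monoʳ-≤-nonNeg ∣ g ε ∣ {{nonNegative (0≤∣p∣ (g ε))}} (hf ε 0≤ε ε≤1) ⟩
  C * ∣ g ε ∣         ≤⟨ *-monoˡ-≤-nonNeg C {{nonNegative (≤-trans (0≤∣p∣ (f ε)) (hf ε 0≤ε ε≤1))}} (hg ε 0≤ε ε≤1) ⟩
  C * D               ∎
  where open ≤-Reasoning

-- The class 1 + O(ε) with an explicit remainder. The identity is algebraic and holds for all ε; the
-- bound refers to [0,1], which contains every 1/n.
NearOne : (ℚ → ℚ) → Set
NearOne u = ∃ λ h → Bounded h × (∀ ε → u ε ≡ 1ℚ + ε * h ε)

nearOne-1 : NearOne (λ _ → 1ℚ)
nearOne-1 = (λ _ → 0ℚ) , bounded-const 0ℚ , λ ε → solve 1 (λ e → con 1ℚ := con 1ℚ :+ e :* con 0ℚ) refl ε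
  where open +-*-Solver

nearOne-* : ∀ {u v} → NearOne u → NearOne v → NearOne (λ ε → u ε * v ε)
nearOne-* (h , bh , eh) (g , bg , eg) =
  (λ ε → h ε + (g ε + ε * (h ε * g ε))) ,
  bounded-+ bh (bounded-+ bg (bounded-* bounded-id (bounded-* bh bg))) ,
  λ ε → trans (cong₂ _*_ (eh ε) (eg ε))
    (solve 3 (λ e h g → (con 1ℚ :+ e :* h) :* (con 1ℚ :+ e :* g) := con 1ℚ :+ e :* (h :+ (g :+ e :* (h :* g)))) refl ε (h ε) (g ε))
  where open +-*-Solver

nearOne-^ : ∀ {u} k → NearOne u → NearOne (λ ε → u ε ^ k)
nearOne-^ zero    h = nearOne-1
nearOne-^ (suc k) h = nearOne-* h (nearOne-^ k h)

falling : ℕ → ℚ → ℚ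
falling zero    ε = 1ℚ
falling (suc N) ε = falling N ε * (1ℚ - ι N * ε)

nearOne-falling : ∀ N → NearOne (falling N)
nearOne-falling zero    = nearOne-1
nearOne-falling (suc N) = nearOne-* (nearOne-falling N)
  ((λ _ → - ι N) , bounded-const (- ι N) , λ ε → solve 2 (λ a e → con 1ℚ :- a :* e := con 1ℚ :+ e :* (:- a)) refl (ι N) ε)
  where open +-*-Solver

injections≡falling : ∀ N n .{{_ : NonZero n}} → inv n ^ N * ι (injections N n) ≡ falling N (inv n)
injections≡falling zero    n = trans (*-identityˡ (ι 1)) ι-1
injections≡falling (suc N) n = begin
  ε * ε ^ N * ι (injections (suc N) n)
    ≡⟨ cong (ε * ε ^ N *_) (ι-injections-suc N n) ⟩
  ε * ε ^ N * ((ι n - ι N) * ι (injections N n))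
    ≡⟨ solve 5 (λ e f n m i → e :* f :* ((n :- m) :* i) := f :* i :* (n :* e :- m :* e))
         refl ε (ε ^ N) (ι n) (ι N) (ι (injections N n)) ⟩
  ε ^ N * ι (injections N n) * (ι n * ε - ι N * ε)
    ≡⟨ cong₂ (λ s t → s * (t - ι N * ε)) (injections≡falling N n) (ι*inv n) ⟩
  falling (suc N) ε ∎
  where
  open ≡-Reasoning
  open +-*-Solver
  ε = inv n

-- One order more than `NearOne`: the leading coefficient `ι k * a` is needed exactly, since at `a`
-- equal to the cycle length it cancels the prefactor and leaves the k of k/n.
Bernoulli : ℕ → ℚ → Set
Bernoulli k a = ∃ λ g → Bounded g × (∀ ε → 1ℚ - (1ℚ - a * ε) ^ k ≡ ε * (ι k * a + ε * g ε))

bernoulli : ∀ k a → Bernoulli k a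
bernoulli zero    a = (λ _ → 0ℚ) , bounded-const 0ℚ ,
  λ ε → trans (solve 2 (λ a e → con 1ℚ :- con 1ℚ := e :* (con 0ℚ :* a :+ e :* con 0ℚ)) refl a ε)
              (cong (λ t → ε * (t * a + ε * 0ℚ)) (sym ι-0))
  where open +-*-Solver
bernoulli (suc k) a with bernoulli k a
-- The new remainder collects the terms of second and higher order in aε + (1-aε)ε(ka+εg), which
-- comes from 1-(1-aε)q = aε + (1-aε)(1-q).
... | g , bg , eg = (λ ε → g ε + (- (a * (ι k * a)) + ε * (- a * g ε))) ,
  bounded-+ bg (bounded-+ (bounded-const (- (a * (ι k * a)))) (bounded-* bounded-id (bounded-* (bounded-const (- a)) bg))) ,
  λ ε → begin
    1ℚ - (1ℚ - a * ε) * (1ℚ - a * ε) ^ k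
      ≡⟨ solve 3 (λ a e q → con 1ℚ :- (con 1ℚ :- a :* e) :* q := a :* e :+ (con 1ℚ :- a :* e) :* (con 1ℚ :- q))
           refl a ε ((1ℚ - a * ε) ^ k) ⟩
    a * ε + (1ℚ - a * ε) * (1ℚ - (1ℚ - a * ε) ^ k)
      ≡⟨ cong (λ t → a * ε + (1ℚ - a * ε) * t) (eg ε) ⟩
    a * ε + (1ℚ - a * ε) * (ε * (ι k * a + ε * g ε))
      ≡⟨ solve 4 (λ a e k g → a :* e :+ (con 1ℚ :- a :* e) :* (e :* (k :* a :+ e :* g))
           := e :* ((con 1ℚ :+ k) :* a :+ e :* (g :+ (:- (a :* (k :* a)) :+ e :* (:- a :* g))))) refl a ε (ι k) (g ε) ⟩
    ε * ((1ℚ + ι k) * a + ε * (g ε + (- (a * (ι k * a)) + ε * (- a * g ε))))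
      ≡⟨ cong (λ t → ε * (t * a + ε * (g ε + (- (a * (ι k * a)) + ε * (- a * g ε))))) (trans (ι-+ 1 k) (cong (_+ ι k) ι-1)) ⟨
    ε * (ι (suc k) * a + ε * (g ε + (- (a * (ι k * a)) + ε * (- a * g ε)))) ∎
  where
  open ≡-Reasoning
  open +-*-Solver

-- Taking the two expansions as arguments keeps their remainders `h` and `g` as atoms for the ring
-- solver.
asymptotic′ : ∀ k N → NearOne (λ ε → falling (suc N) ε ^ suc k) → Bernoulli (suc k) (ι (suc N)) →
  ∃ λ C → ∀ n .{{_ : NonZero n}} →
  ∣ p (suc k) (suc N) n - + suc k / n ∣ ≤ C * (+ 1 / (n ℕ.^ 2)) {{m^n≢0 n 2}}
asymptotic′ k N (h , bh , eh) (g , bg , eg) = C , bound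
  where
  open +-*-Solver
  c = inv (suc N)
  N̂ = ι (suc N)
  K̂ = ι (suc k)
  remainder : ℚ → ℚ
  remainder ε = c * (g ε + h ε * (K̂ * N̂ + ε * g ε))
  bounded-remainder : Bounded remainder
  bounded-remainder = bounded-* (bounded-const c) (bounded-+ bg
    (bounded-* bh (bounded-+ (bounded-const (K̂ * N̂)) (bounded-* bounded-id bg))))
  C = proj₁ bounded-remainder

  expansion : ∀ n .{{_ : NonZero n}} → p (suc k) (suc N) n - + suc k / n ≡ remainder (inv n) * (inv n ^ 2)
  expansion n = begin
    p (suc k) (suc N) n - + suc k / n
      ≡⟨ cong₂ _-_ (p-formula k N n) (/≡ι*inv (suc k) n) ⟩
    c * ((ε ^ suc N * ι (injections (suc N) n)) ^ suc k * (1ℚ - (1ℚ - N̂ * ε) ^ suc k)) - K̂ * ε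
      ≡⟨ cong₂ (λ s t → c * (s * t) - K̂ * ε) (trans (cong (_^ suc k) (injections≡falling (suc N) n)) (eh ε)) (eg ε) ⟩
    c * ((1ℚ + ε * h ε) * (ε * (K̂ * N̂ + ε * g ε))) - K̂ * ε
      -- The first-order part is isolated with the coefficient `N̂ * c - 1ℚ`, which vanishes because
      -- `c` is the inverse of `N̂`.
      ≡⟨ solve 6 (λ c e h g k m →
           c :* ((con 1ℚ :+ e :* h) :* (e :* (k :* m :+ e :* g))) :- k :* e
           := (m :* c :- con 1ℚ) :* (k :* e) :+ c :* (g :+ h :* (k :* m :+ e :* g)) :* (e :* (e :* con 1ℚ)))
           refl c ε (h ε) (g ε) K̂ N̂ ⟩
    (N̂ * c - 1ℚ) * (K̂ * ε) + remainder ε * ε ^ 2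
      ≡⟨ cong (λ t → (t - 1ℚ) * (K̂ * ε) + remainder ε * ε ^ 2) (ι*inv (suc N)) ⟩
    (1ℚ - 1ℚ) * (K̂ * ε) + remainder ε * ε ^ 2
      ≡⟨ solve 2 (λ x y → (con 1ℚ :- con 1ℚ) :* x :+ y := y) refl (K̂ * ε) (remainder ε * ε ^ 2) ⟩
    remainder ε * ε ^ 2 ∎
    where
    open ≡-Reasoning
    ε = inv n

  bound : ∀ n .{{_ : NonZero n}} → ∣ p (suc k) (suc N) n - + suc k / n ∣ ≤ C * (+ 1 / (n ℕ.^ 2)) {{m^n≢0 n 2}}
  bound n = begin
    ∣ p (suc k) (suc N) n - + suc k / n ∣     ≡⟨ cong ∣_∣ (expansion n) ⟩
    ∣ remainder ε * ε ^ 2 ∣                   ≡⟨ ∣p*q∣≡∣p∣*∣q∣ (remainder ε) (ε ^ 2) ⟩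
    ∣ remainder ε ∣ * ∣ ε ^ 2 ∣               ≡⟨ cong (λ t → ∣ remainder ε ∣ * ∣ t ∣) (inv-^ n 2 {{_}} {{m^n≢0 n 2}}) ⟨
    ∣ remainder ε ∣ * ∣ ε² ∣                  ≡⟨ cong (∣ remainder ε ∣ *_) (0≤p⇒∣p∣≡p (0≤inv (n ℕ.^ 2) {{m^n≢0 n 2}})) ⟩
    ∣ remainder ε ∣ * ε²                      ≤⟨ *-monoʳ-≤-nonNeg ε² {{nonNegative (0≤inv (n ℕ.^ 2) {{m^n≢0 n 2}})}}
                                                  (proj₂ bounded-remainder ε (0≤inv n) (inv≤1 n)) ⟩
    C * ε²                                    ≡⟨ cong (C *_) (1/≡inv (n ℕ.^ 2) {{m^n≢0 n 2}}) ⟨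
    C * (+ 1 / (n ℕ.^ 2)) {{m^n≢0 n 2}} ∎
    where
    open ≤-Reasoning
    ε = inv n
    ε² = inv (n ℕ.^ 2) {{m^n≢0 n 2}}

asymptotic : ∀ k N → ∃ λ C → ∀ n .{{_ : NonZero n}} →
  ∣ p (suc k) (suc N) n - + suc k / n ∣ ≤ C * (+ 1 / (n ℕ.^ 2)) {{m^n≢0 n 2}}
asymptotic k N = asymptotic′ k N (nearOne-^ (suc k) (nearOne-falling (suc N))) (bernoulli (suc k) (ι (suc N)))

corollary4p8 : (k N : ℕ) .{{_ : NonZero k}} .{{_ : NonZero N}} →
    ((n : ℕ) .{{_ : NonZero n}} → N ℕ.+ 1 ℕ.≤ n →
    p k N n ≡
    (+ 1 / N)
    * (+ 1 / (n ℕ.^ (k ℕ.* (N ∸ 1)))) {{m^n≢0 n (k ℕ.* (N ∸ 1))}}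
    * ((+ ((n ∸ 1) !) / ((n ∸ N) !)) {{(n ∸ N) !≢0}}) ^ k
    * (1ℚ - (1ℚ - + N / n) ^ k))
    × (∃ λ (C : ℚ) → ∃ λ (n₀ : ℕ) →
    (n : ℕ) .{{_ : NonZero n}} → N ℕ.+ 1 ℕ.≤ n → n₀ ℕ.≤ n →
    ∣ p k N n - + k / n ∣ ≤ C * (+ 1 / (n ℕ.^ 2)) {{m^n≢0 n 2}})
corollary4p8 (suc k) (suc N) =
  (λ n N<n → exact k N n (ℕ.m+n≤o⇒m≤o (suc N) N<n)) ,
  -- The threshold can be 0, as the remainder is bounded on all of [0,1] and not only near 0.
  (let C , bound = asymptotic k N in C , 0 , λ n _ _ → bound n)
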